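{- For any constant $s\ge 4$ there is a 1-sided error distributed property-testing algorithm for $K_s$-freeness in the CONGEST model with running time $$O\!\left(\epsilon^{ -\frac{s}{2(s-2)}}\, m^{\frac{s-4}{2(s-2)}}\right)$$ rounds, where $m$ is the number of edges of the network graph (for $s\ge 5$ the nodes are assumed to know $m$ up to a constant factor; the hidden constant may depend on $s$).
   Context: CONGEST model: the network is an undirected graph $G=(V,E)$ with $n=|V|$ nodes and $m=|E|$ edges, nodes have unique $O(\log n)$-bit identifiers; computation is synchronous, and in each round every node may send $O(\log n)$ bits over each incident edge; nodes have private randomness. "Subgraph" means not-necessarily-induced subgraph; $K_s$ is the clique on $s$ vertices. $G$ is $H$-free if it contains no subgraph isomorphic to $H$. $G$ is $\epsilon$-far from a property if at least $\epsilon|E|$ edges must be added to or removed from $E$ to obtain a graph with the property. Testing $H$-freeness with parameter $0<\epsilon\le 1$ (known to the algorithm): if $G$ is $H$-free then with probability at least $2/3$ all nodes accept; if $G$ is $\epsilon$-far from $H$-free then with probability at least $2/3$ some node rejects. The algorithm has 1-sided error if, whenever $G$ is $H$-free, all nodes accept with probability 1. -}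

module Defs where

open import Algebra.Definitions.RawSemiring using () renaming (_^_ to pow)
open import Data.Bool.Base using (Bool; true; false; T; not; _xor_)
import Data.Bool.Properties as Bool
open import Data.Fin.Base using (Fin; toℕ)
import Data.Fin.Properties as Fin
open import Data.Integer.Base using (+_)
open import Data.List.Base
  using (List; []; _∷_; [_]; length; map; filter; filterᵇ; allFin; cartesianProduct; cartesianProductWith)
open import Data.List.Properties using (length-map; length-++)
open import Data.Maybe using (Maybe; just; nothing; Is-just)
import Data.Maybe.Properties as Maybe
open import Data.Nat.Base using (ℕ; zero; suc; _+_; _*_; _∸_; _^_; _≤_; _<_; _<ᵇ_)
open import Data.Nat.Properties using (m^n≢0; ^-*-assoc; *-comm)
open import Data.Product.Base using (∃; _×_; _,_; proj₁; proj₂)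
open import Data.Rational.Base as ℚ using (ℚ; 1ℚ; _/_)
open import Data.Vec.Base using (Vec; []; _∷_; lookup)
open import Function.Bundles using (_↔_; Inverse)
open import Function.Definitions using (Injective)
open import Relation.Binary.PropositionalEquality
  using (_≡_; refl; sym; trans; cong; cong₂; subst)
open import Relation.Nullary using (¬_)
open import Relation.Nullary.Decidable.Core using (does; yes; no)
open import Relation.Nullary.Negation using (contradiction)
open import Relation.Unary using (Pred; Decidable)
open import Level using (0ℓ)

------------------------------------------------------------------------
-- Finite simple graphs

record Graph (n : ℕ) : Set where
  field
    edge   : Fin n → Fin n → Bool
    symm   : ∀ u v → edge u v ≡ edge v u
    irrefl : ∀ v → edge v v ≡ false

open Graph public

-- Unordered pairs of distinct vertices, represented with the smaller one first.
pairs : ∀ n → List (Fin n × Fin n)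
pairs n = filterᵇ (λ (u , v) → toℕ u <ᵇ toℕ v) (cartesianProduct (allFin n) (allFin n))

edgeCount : ∀ {n} → Graph n → ℕ
edgeCount {n} G = length (filterᵇ (λ (u , v) → edge G u v) (pairs n))

-- The number of edge insertions and deletions that turn G into G′.
editDistance : ∀ {n} → Graph n → Graph n → ℕ
editDistance {n} G G′ =
  length (filterᵇ (λ (u , v) → edge G u v xor edge G′ u v) (pairs n))

K : ∀ s → Graph s
K s = record
  { edge   = λ i j → not (does (i Fin.≟ j))
  ; symm   = λ i j → cong not (does-sym i j)
  ; irrefl = λ i → cong not (does-refl i)
  }
  where
  does-sym : ∀ i j → does (i Fin.≟ j) ≡ does (j Fin.≟ i)
  does-sym i j with i Fin.≟ j | j Fin.≟ i
  ... | yes _ | yes _ = refl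
  ... | no  _ | no  _ = refl
  ... | yes p | no ¬q = contradiction (sym p) ¬q
  ... | no ¬p | yes q = contradiction (sym q) ¬p

  does-refl : ∀ i → does (i Fin.≟ i) ≡ true
  does-refl i with i Fin.≟ i
  ... | yes _ = refl
  ... | no ¬p = contradiction refl ¬p

-- Subgraphs need not be induced.
_⊑_ : ∀ {h n} → Graph h → Graph n → Set
H ⊑ G = ∃ λ φ → Injective _≡_ _≡_ φ × (∀ i j → T (edge H i j) → T (edge G (φ i) (φ j)))

_-Free : ∀ {h n} → Graph h → Graph n → Set
(H -Free) G = ¬ (H ⊑ G)

fromℕ : ℕ → ℚ
fromℕ k = + k / 1

Far : ∀ {n} → ℚ → (Graph n → Set) → Graph n → Set
Far ε P G = ∀ G′ → P G′ → ε ℚ.* fromℕ (edgeCount G) ℚ.≤ fromℕ (editDistance G G′)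

------------------------------------------------------------------------
-- CONGEST networks

-- `port v` is an arbitrary numbering of the edges at v; it forces `deg v` to be
-- the degree of v.
record Network (b : ℕ) : Set where
  field
    {n}    : ℕ
    graph  : Graph n
    ident  : Fin n → Vec Bool b
    unique : Injective _≡_ _≡_ ident
    deg    : Fin n → ℕ
    port   : ∀ v → Fin (deg v) ↔ ∃ λ u → T (edge graph v u)

  neighbour : ∀ v → Fin (deg v) → Fin n
  neighbour v i = proj₁ (Inverse.to (port v) i)

  -- The port of `neighbour v i` that leads back to v.
  back : ∀ v i → Fin (deg (neighbour v i))
  back v i with u , vu ← Inverse.to (port v) i =
    Inverse.from (port u) (v , subst T (symm graph v u) vu)

Message : Set
Message = List Bool

-- The program run by every node.  A node starts with its identifier, its degree
-- and its own private coin flips.  It halts once `verdict` is `just`, where `true`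
-- means accept and `false` means reject.
record Protocol (b : ℕ) : Set₁ where
  field
    coins   : ℕ
    State   : ℕ → Set
    init    : Vec Bool b → (d : ℕ) → Vec Bool coins → State d
    send    : ∀ {d} → State d → Fin d → Message
    receive : ∀ {d} → State d → (Fin d → Message) → State d
    verdict : ∀ {d} → State d → Maybe Bool

------------------------------------------------------------------------
-- Probability over the private coins

sequences : ∀ {A : Set} → List A → ∀ k → List (Vec A k)
sequences xs zero    = [ [] ]
sequences xs (suc k) = cartesianProductWith _∷_ xs (sequences xs k)

Coins : ℕ → ℕ → Set
Coins n r = Vec (Vec Bool r) n

outcomes : ∀ n r → List (Coins n r)
outcomes n r = sequences (sequences (true ∷ false ∷ []) r) n

length-sequences : ∀ {A : Set} (xs : List A) k → length (sequences xs k) ≡ length xs ^ k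
length-sequences xs zero    = refl
length-sequences xs (suc k) =
  trans (length-product xs) (cong (length xs *_) (length-sequences xs k))
  where
  length-product : ∀ ys →
    length (cartesianProductWith _∷_ ys (sequences xs k)) ≡ length ys * length (sequences xs k)
  length-product []       = refl
  length-product (y ∷ ys) =
    trans (length-++ (map (y ∷_) (sequences xs k)))
          (cong₂ _+_ (length-map (y ∷_) (sequences xs k)) (length-product ys))

-- Justifies the denominator of Pr.
length-outcomes : ∀ n r → length (outcomes n r) ≡ 2 ^ (n * r)
length-outcomes n r =
  trans (length-sequences (sequences (true ∷ false ∷ []) r) n)
  (trans (cong (_^ n) (length-sequences (true ∷ false ∷ []) r))
  (trans (^-*-assoc 2 r n) (cong (2 ^_) (*-comm r n))))

Pr : ∀ {n r} {P : Pred (Coins n r) 0ℓ} → Decidable P → ℚ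
Pr {n} {r} P? =
  _/_ (+ length (filter P? (outcomes n r))) (2 ^ (n * r)) {{m^n≢0 2 (n * r)}}

------------------------------------------------------------------------
-- Executions

module Execution {b} (A : Protocol b) (N : Network b) where
  open Protocol A
  open Network N

  Config : Set
  Config = ∀ v → State (deg v)

  -- A halted node stays silent and keeps its state.
  sent : Config → ∀ v → Fin (deg v) → Message
  sent σ v i with verdict (σ v)
  ... | just _  = []
  ... | nothing = send (σ v) i

  step : Config → Config
  step σ v with verdict (σ v)
  ... | just _  = σ v
  ... | nothing = receive (σ v) λ i → sent σ (neighbour v i) (back v i)

  run : Coins n coins → ℕ → Config
  run ω zero    v = init (ident v) (deg v) (lookup ω v)
  run ω (suc t)   = step (run ω t)

  output : ℕ → Coins n coins → Fin n → Maybe Bool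
  output t ω v = verdict (run ω t v)

  HaltsWithin : ℕ → Set
  HaltsWithin t = ∀ ω v → Is-just (output t ω v)

  Bandwidth≤ : ℕ → Set
  Bandwidth≤ w = ∀ ω t v i → length (sent (run ω t) v i) ≤ w

  AllAccept SomeRejects : ℕ → Pred (Coins n coins) 0ℓ
  AllAccept   t ω = ∀ v → output t ω v ≡ just true
  SomeRejects t ω = ∃ λ v → output t ω v ≡ just false

  allAccept? : ∀ t → Decidable (AllAccept t)
  allAccept? t ω = Fin.all? λ v → Maybe.≡-dec Bool._≟_ (output t ω v) (just true)

  someRejects? : ∀ t → Decidable (SomeRejects t)
  someRejects? t ω = Fin.any? λ v → Maybe.≡-dec Bool._≟_ (output t ω v) (just false)

-- Correctness, on the network N, of the outputs present after t rounds.
-- `complete` subsumes the probability 2/3 required of two-sided testers.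
-- An edgeless graph is literally ε-far from every property (at least 0 edges must
-- change), and so is both free and far; hence `0 < edgeCount graph`.
record OneSidedTester {h b} (H : Graph h) (ε : ℚ) (A : Protocol b) (N : Network b) (t : ℕ)
  : Set where
  open Network N
  open Execution A N
  field
    complete : (H -Free) graph → Pr (allAccept? t) ≡ 1ℚ
    sound    : 0 < edgeCount graph → Far ε (H -Free) graph →
               + 2 / 3 ℚ.≤ Pr (someRejects? t)

------------------------------------------------------------------------
-- Global knowledge and running time

-- What nodes are told about m when testing K s: nothing for s = 4, and a value
-- within a factor γ of m for s ≥ 5.
data EdgeHint (γ m : ℕ) : ℕ → Maybe ℕ → Set where
  none     : EdgeHint γ m 4 nothing
  estimate : ∀ {s m̃} → 5 ≤ s → m ≤ γ * m̃ → m̃ ≤ γ * m → EdgeHint γ m s (just m̃)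

-- An algorithm knows ε, the hint about m and the length b of the identifiers.
Algorithm : Set₁
Algorithm = ℚ → Maybe ℕ → (b : ℕ) → Protocol b

_^ℚ_ : ℚ → ℕ → ℚ
_^ℚ_ = pow ℚ.+-*-rawSemiring

-- t ≤ C · ε^(-s/(2(s-2))) · m^((s-4)/(2(s-2))), for ε > 0 and s ≥ 4, with both sides
-- raised to the power 2(s-2) and multiplied by ε^s to clear fractional exponents.
RoundBound : (s C : ℕ) (ε : ℚ) (m t : ℕ) → Set
RoundBound s C ε m t =
  fromℕ (t ^ (2 * (s ∸ 2))) ℚ.* (ε ^ℚ s) ℚ.≤ fromℕ (C ^ (2 * (s ∸ 2)) * m ^ (s ∸ 4))

{-# OPTIONS --safe #-}

-- Any graph that is ε-far from K_s-free contains, among the edges uv with deg u · deg v = O(m/ε),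
-- a family of Ω(εm) pairwise edge-disjoint copies of K_s: the other edges number at most εm/2,
-- and removing them together with a maximal family leaves no copy.  Each of these copies has a
-- vertex u, its apex, of degree O(√(m/ε)).  A node splits its ports into t blocks and, for each of
-- s - 2 roles, picks one random port in every block and asks all neighbours whether they are
-- adjacent to the node behind it; so u finds the copy once each of s - 2 other vertices of the
-- copy is picked in its own role, the last vertex being seen through its answers.  This happens
-- with probability Ω((t / deg u)^(s-2)), and it takes t² ~ (m/ε) / (εm)^(2/(s-2)) to make the
-- expected number of copies found at least 2.  Copies with a common apex share no other vertex,
-- so the events that they are found are either independent or mutually exclusive, and the second
-- moment method shows that some copy is found with probability at least 2/3.
module Submission where

open import Defs
open import Algebra.Bundles using (CommutativeMonoid)
import Algebra.Properties.CommutativeMonoid.Sum as CommutativeMonoidSum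
import Algebra.Properties.CommutativeSemigroup as CommutativeSemigroup
import Algebra.Properties.Semiring.Sum as SemiringSum
open import Data.Bool.Base using (Bool; true; false; T; not; _∧_; _xor_; if_then_else_)
import Data.Bool.Properties as Bool
open import Data.Empty using (⊥-elim)
open import Data.Fin.Base as Fin using (Fin; zero; suc; toℕ; combine; remQuot; fromℕ<; funToFin; _↑ˡ_; _↑ʳ_)
import Data.Fin.Properties as Fin
import Data.Integer.Base as ℤ
import Data.Integer.Properties as ℤ
open import Data.List.Base as List using (List; []; _∷_; _++_; length; filter; filterᵇ; allFin; cartesianProduct; cartesianProductWith)
open import Data.List.Properties using (map-tabulate; map-++; filter-all)
import Data.List.Relation.Unary.All as All
open import Data.Maybe using (Is-just)
open import Data.Maybe.Base using (Maybe; just; nothing; fromMaybe)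
import Data.Maybe.Properties as Maybe
open import Data.Maybe.Relation.Unary.Any using (just)
open import Data.Nat.Base
open import Data.Nat.DivMod using (_mod_; m≡m%n+[m/n]*n; m<n*o⇒m/o<n; m%n<n)
open import Data.Nat.ListAction using () renaming (sum to sumₗ)
open import Data.Nat.ListAction.Properties using () renaming (sum-++ to sumₗ-++)
open import Data.Nat.Logarithm using (⌈log₂_⌉; ⌈log₂⌉-mono-≤)
open import Data.Nat.Properties
open import Data.Nat.Tactic.RingSolver using (solve-∀)
open import Data.Product.Base using (Σ; ∃; ∃₂; _×_; _,_; proj₁; proj₂)
open import Data.Rational.Base as ℚ using (ℚ; 0ℚ; 1ℚ)
import Data.Rational.Properties as ℚ
import Data.Rational.Unnormalised.Base as ℚᵘ
import Data.Rational.Unnormalised.Properties as ℚᵘ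
open import Data.Sum.Base using (_⊎_; inj₁; inj₂)
open import Data.Vec.Base as Vec using (Vec; []; _∷_; lookup; tabulate; toList)
import Data.Vec.Properties as Vec
open import Level using (0ℓ)
open import Function.Base using (_∘_; id)
open import Function.Bundles using (Inverse)
open import Function.Definitions using (Injective)
open import Relation.Binary.Definitions using (tri<; tri≈; tri>)
open import Relation.Binary.PropositionalEquality
open import Relation.Nullary
open import Relation.Nullary.Decidable using (map′; _×-dec_; _→-dec_; ¬?; T?; dec-true; dec-false)
open import Relation.Unary using (Pred; Decidable)

-- The number of blocks is the same at every node, so all nodes follow one query schedule; the
-- degree enters only through the block size. Since coins are bits, a position is drawn from
-- `2 ^ width d` addresses, some of them vacant. Minimality of the width gives
-- `blocks * 2 ^ width d ≤ 2 * d`, a loss of a factor 2 per role, except when the width is 0. An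
-- apex of width 0 selects all its ports whatever the coins are, so it settles detection alone, and
-- the second moment method is needed only when no apex has width 0.
--
-- The event that an apex picks its copy prescribes certain coins, so it is a cylinder: its
-- probability is a product over coins, independence becomes disjointness of the prescribed coins,
-- and exclusion becomes one coin prescribed in two ways. If `X` counts the events and has mean `μ`,
-- then the mean of `X * X` is at most `μ * μ + μ`, so `X` is positive with probability at least
-- `μ / (1 + μ)`; this is why `μ ≥ 2` yields 2/3.
--
-- Probabilities are counts of coin sequences, `ε` is a fraction `p / q` with denominators cleared,
-- and fractional exponents are avoided by fixing the number of blocks through its power
-- `2 * (s - 2)`.

module Sum = SemiringSum +-*-semiring
module Product = CommutativeMonoidSum *-1-commutativeMonoid

-- Finite sums and products

-- Opacity lets the unifier see through ∑ and ∏.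
opaque
  ∑ ∏ : ∀ {n} → (Fin n → ℕ) → ℕ
  ∑ = Sum.sum
  ∏ = Product.sum

  ∑-cong : ∀ {n} {f g : Fin n → ℕ} → f ≗ g → ∑ f ≡ ∑ g
  ∑-cong = Sum.sum-cong-≗

  ∏-cong : ∀ {n} {f g : Fin n → ℕ} → f ≗ g → ∏ f ≡ ∏ g
  ∏-cong = Product.sum-cong-≗

  ∑-+ : ∀ {n} (f g : Fin n → ℕ) → ∑ (λ i → f i + g i) ≡ ∑ f + ∑ g
  ∑-+ = Sum.∑-distrib-+

  ∏-* : ∀ {n} (f g : Fin n → ℕ) → ∏ (λ i → f i * g i) ≡ ∏ f * ∏ g
  ∏-* = Product.∑-distrib-+

  ∑-comm : ∀ {m n} (f : Fin m → Fin n → ℕ) → ∑ (λ i → ∑ (f i)) ≡ ∑ (λ j → ∑ (λ i → f i j))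
  ∑-comm = Sum.∑-comm

  *-distribˡ-∑ : ∀ {n} c (f : Fin n → ℕ) → c * ∑ f ≡ ∑ (λ i → c * f i)
  *-distribˡ-∑ = Sum.*-distribˡ-sum

  *-distribʳ-∑ : ∀ {n} c (f : Fin n → ℕ) → ∑ f * c ≡ ∑ (λ i → f i * c)
  *-distribʳ-∑ = Sum.*-distribʳ-sum

  ∏-empty : (f : Fin 0 → ℕ) → ∏ f ≡ 1
  ∏-empty f = refl

  ∏-suc : ∀ {n} (f : Fin (suc n) → ℕ) → ∏ f ≡ f zero * ∏ (f ∘ suc)
  ∏-suc f = refl

  ∑-mono : ∀ {n} {f g : Fin n → ℕ} → (∀ i → f i ≤ g i) → ∑ f ≤ ∑ g
  ∑-mono {zero}  f≤g = z≤n
  ∑-mono {suc n} f≤g = +-mono-≤ (f≤g zero) (∑-mono (f≤g ∘ suc))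

  ∑-const : ∀ n c → ∑ {n} (λ _ → c) ≡ n * c
  ∑-const zero    c = refl
  ∑-const (suc n) c = cong (c +_) (∑-const n c)

  ∑-lower : ∀ {n c} {f : Fin n → ℕ} → (∀ i → c ≤ f i) → n * c ≤ ∑ f
  ∑-lower {n} {c} c≤f = ≤-trans (≤-reflexive (sym (∑-const n c))) (∑-mono c≤f)

  term≤∑ : ∀ {n} (f : Fin n → ℕ) i → f i ≤ ∑ f
  term≤∑ f zero    = m≤m+n _ _
  term≤∑ f (suc i) = ≤-trans (term≤∑ (f ∘ suc) i) (m≤n+m _ _)

  ∑-strict : ∀ {n} {f g : Fin n → ℕ} → (∀ i → f i ≤ g i) → ∀ i → f i < g i → ∑ f < ∑ g
  ∑-strict f≤g zero    f<g = +-mono-<-≤ f<g (∑-mono (f≤g ∘ suc))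
  ∑-strict f≤g (suc i) f<g = +-mono-≤-< (f≤g zero) (∑-strict (f≤g ∘ suc) i f<g)

  ∑>0⇒∃ : ∀ {n} (f : Fin n → ℕ) → 0 < ∑ f → ∃ λ i → 0 < f i
  ∑>0⇒∃ {suc n} f 0<∑ with f zero in eq
  ... | suc _ = zero , subst (0 <_) (sym eq) z<s
  ... | zero  with i , 0<fi ← ∑>0⇒∃ (f ∘ suc) 0<∑ = suc i , 0<fi

  ∑-* : ∀ {m n} (f : Fin m → ℕ) (g : Fin n → ℕ) → ∑ (λ i → ∑ (λ j → f i * g j)) ≡ ∑ f * ∑ g
  ∑-* f g = trans (∑-cong (λ i → sym (*-distribˡ-∑ (f i) g))) (sym (*-distribʳ-∑ (∑ g) f))

  ∏-mono : ∀ {n} {f g : Fin n → ℕ} → (∀ i → f i ≤ g i) → ∏ f ≤ ∏ g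
  ∏-mono {zero}  f≤g = ≤-refl
  ∏-mono {suc n} f≤g = *-mono-≤ (f≤g zero) (∏-mono (f≤g ∘ suc))

  ∏-const : ∀ n c → ∏ {n} (λ _ → c) ≡ c ^ n
  ∏-const zero    c = refl
  ∏-const (suc n) c = cong (c *_) (∏-const n c)

  ∏-upper : ∀ {n c} {f : Fin n → ℕ} → (∀ i → f i ≤ c) → ∏ f ≤ c ^ n
  ∏-upper {n} {c} f≤c = ≤-trans (∏-mono f≤c) (≤-reflexive (∏-const n c))

  ∏-zero : ∀ {n} (f : Fin n → ℕ) i → f i ≡ 0 → ∏ f ≡ 0
  ∏-zero f zero    f≡0 rewrite f≡0 = refl
  ∏-zero f (suc i) f≡0 rewrite ∏-zero (f ∘ suc) i f≡0 = *-zeroʳ (f zero)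

  ∏>0⇒ : ∀ {n} (f : Fin n → ℕ) → 0 < ∏ f → ∀ i → 0 < f i
  ∏>0⇒ f 0<∏ i with f i in eq
  ... | suc _ = z<s
  ... | zero  = contradiction (∏-zero f i eq) (>⇒≢ 0<∏)

  ∏-ones : ∀ {n} {f : Fin n → ℕ} → (∀ i → f i ≡ 1) → ∏ f ≡ 1
  ∏-ones {n} f≡1 = trans (∏-cong f≡1) (trans (∏-const n 1) (^-zeroˡ n))

  ∏-single : ∀ {n} (f : Fin n → ℕ) i → (∀ j → j ≢ i → f j ≡ 1) → ∏ f ≡ f i
  ∏-single f zero    rest =
    trans (cong (f zero *_) (∏-ones (λ j → rest (suc j) λ ()))) (*-identityʳ _)
  ∏-single f (suc i) rest = begin
    f zero * ∏ (f ∘ suc) ≡⟨ cong₂ _*_ (rest zero λ ()) (∏-single (f ∘ suc) i λ j j≢i → rest (suc j) (j≢i ∘ Fin.suc-injective)) ⟩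
    1 * f (suc i)        ≡⟨ *-identityˡ _ ⟩
    f (suc i)            ∎
    where open ≡-Reasoning

  ∏-++ : ∀ m {n} (f : Fin (m + n) → ℕ) → ∏ f ≡ ∏ (λ i → f (i ↑ˡ n)) * ∏ (λ j → f (m ↑ʳ j))
  ∏-++ zero    f = sym (*-identityˡ _)
  ∏-++ (suc m) f = trans (cong (f zero *_) (∏-++ m (f ∘ suc))) (sym (*-assoc (f zero) _ _))

  ∏-combine : ∀ m {n} (f : Fin (m * n) → ℕ) → ∏ f ≡ ∏ (λ i → ∏ (λ j → f (combine {m} {n} i j)))
  ∏-combine zero    f = refl
  ∏-combine (suc m) {n} f =
    trans (∏-++ n f) (cong (∏ (λ j → f (j ↑ˡ (m * n))) *_) (∏-combine m (λ i → f (n ↑ʳ i))))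

⟦_⟧ : Bool → ℕ
⟦ true  ⟧ = 1
⟦ false ⟧ = 0

⟦⟧≤1 : ∀ x → ⟦ x ⟧ ≤ 1
⟦⟧≤1 true  = ≤-refl
⟦⟧≤1 false = z≤n

T⇒⟦⟧ : ∀ {x} → T x → ⟦ x ⟧ ≡ 1
T⇒⟦⟧ {true} _ = refl

opaque
  unfolding ∑

  ∑-indicator : ∀ {n} (i : Fin n) → ∑ (λ j → ⟦ does (i Fin.≟ j) ⟧) ≡ 1
  ∑-indicator {suc n} zero    = cong suc (trans (∑-const n 0) (*-zeroʳ n))
  ∑-indicator {suc n} (suc i) = trans (∑-cong eq) (∑-indicator i)
    where
    eq : ∀ j → ⟦ does (suc i Fin.≟ suc j) ⟧ ≡ ⟦ does (i Fin.≟ j) ⟧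
    eq j with i Fin.≟ j
    ... | yes _ = refl
    ... | no  _ = refl

  ∑-fibre : ∀ {k n} (f : Fin k → Fin n) → Injective _≡_ _≡_ f → ∀ w → ∑ (λ i → ⟦ does (f i Fin.≟ w) ⟧) ≤ 1
  ∑-fibre {zero}  f inj w = z≤n
  ∑-fibre {suc k} f inj w with f zero Fin.≟ w
  ... | no  _    = ∑-fibre (f ∘ suc) (Fin.suc-injective ∘ inj) w
  ... | yes refl = s≤s (≤-trans (∑-mono {g = λ _ → 0} others) (≤-reflexive (trans (∑-const k 0) (*-zeroʳ k))))
    where
    others : ∀ i → ⟦ does (f (suc i) Fin.≟ f zero) ⟧ ≤ 0
    others i with f (suc i) Fin.≟ f zero
    ... | no  _  = z≤n
    ... | yes eq = contradiction (inj eq) λ ()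

-- Double counting of the pairs `(i , w)` with `f i ≡ w`. It turns the ports of a node into a bound
-- of its degree by a row sum of the adjacency matrix.
injection-count : ∀ {k n} (f : Fin k → Fin n) → Injective _≡_ _≡_ f →
                  (p : Fin n → Bool) → (∀ i → T (p (f i))) → k ≤ ∑ (λ w → ⟦ p w ⟧)
injection-count {k} f inj p Tp = begin
  k                                                 ≡⟨ trans (∑-const k 1) (*-identityʳ k) ⟨
  ∑ (λ i → 1)                                       ≡⟨ ∑-cong (λ i → ∑-indicator (f i)) ⟨
  ∑ (λ i → ∑ (λ w → ⟦ does (f i Fin.≟ w) ⟧))         ≡⟨ ∑-comm (λ i w → ⟦ does (f i Fin.≟ w) ⟧) ⟩
  ∑ (λ w → ∑ (λ i → ⟦ does (f i Fin.≟ w) ⟧))         ≤⟨ ∑-mono bound ⟩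
  ∑ (λ w → ⟦ p w ⟧)                                 ∎
  where
  open ≤-Reasoning
  bound : ∀ w → ∑ (λ i → ⟦ does (f i Fin.≟ w) ⟧) ≤ ⟦ p w ⟧
  bound w with p w in eq
  ... | true  = ∑-fibre f inj w
  ... | false = ≤-trans (∑-mono {g = λ _ → 0} outside) (≤-reflexive (trans (∑-const k 0) (*-zeroʳ k)))
    where
    outside : ∀ i → ⟦ does (f i Fin.≟ w) ⟧ ≤ 0
    outside i with f i Fin.≟ w
    ... | no  _    = z≤n
    ... | yes refl = ⊥-elim (subst T eq (Tp i))

-- Weighted counting over lists

tally : ∀ {A : Set} → (A → ℕ) → List A → ℕ
tally f xs = sumₗ (List.map f xs)

module _ {A : Set} where

  tally-cong : ∀ {f g : A → ℕ} → f ≗ g → tally f ≗ tally g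
  tally-cong f≗g []       = refl
  tally-cong f≗g (x ∷ xs) = cong₂ _+_ (f≗g x) (tally-cong f≗g xs)

  tally-mono : ∀ {f g : A → ℕ} → (∀ x → f x ≤ g x) → ∀ xs → tally f xs ≤ tally g xs
  tally-mono f≤g []       = z≤n
  tally-mono f≤g (x ∷ xs) = +-mono-≤ (f≤g x) (tally-mono f≤g xs)

  tally-++ : ∀ (f : A → ℕ) xs ys → tally f (xs ++ ys) ≡ tally f xs + tally f ys
  tally-++ f xs ys = trans (cong sumₗ (map-++ f xs ys)) (sumₗ-++ (List.map f xs) _)

  tally-+ : ∀ (f g : A → ℕ) xs → tally (λ x → f x + g x) xs ≡ tally f xs + tally g xs
  tally-+ f g []       = refl
  tally-+ f g (x ∷ xs) rewrite tally-+ f g xs = lemma (f x) (g x) (tally f xs) (tally g xs)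
    where
    lemma : ∀ a b c d → a + b + (c + d) ≡ a + c + (b + d)
    lemma = solve-∀

  tally-*ˡ : ∀ c (f : A → ℕ) xs → tally (λ x → c * f x) xs ≡ c * tally f xs
  tally-*ˡ c f []       = sym (*-zeroʳ c)
  tally-*ˡ c f (x ∷ xs) rewrite tally-*ˡ c f xs = sym (*-distribˡ-+ c (f x) _)

  tally-*ʳ : ∀ c (f : A → ℕ) xs → tally (λ x → f x * c) xs ≡ tally f xs * c
  tally-*ʳ c f []       = refl
  tally-*ʳ c f (x ∷ xs) rewrite tally-*ʳ c f xs = sym (*-distribʳ-+ c (f x) _)

  opaque
    unfolding ∑

    tally-∑ : ∀ {n} (f : Fin n → A → ℕ) xs → tally (λ x → ∑ (λ i → f i x)) xs ≡ ∑ (λ i → tally (f i) xs)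
    tally-∑ {zero}  f xs = zeros xs
      where
      zeros : ∀ xs → tally {A} (λ _ → 0) xs ≡ 0
      zeros []       = refl
      zeros (_ ∷ xs) = zeros xs
    tally-∑ {suc n} f xs = trans (tally-+ (f zero) _ xs) (cong (tally (f zero) xs +_) (tally-∑ (f ∘ suc) xs))

  length-filter≡tally : ∀ {p} {P : Pred A p} (P? : Decidable P) xs →
                        length (filter P? xs) ≡ tally (λ x → ⟦ does (P? x) ⟧) xs
  length-filter≡tally P? []       = refl
  length-filter≡tally P? (x ∷ xs) with does (P? x)
  ... | true  = cong suc (length-filter≡tally P? xs)
  ... | false = length-filter≡tally P? xs

  tally-filterᵇ : ∀ (p : A → Bool) (f : A → ℕ) xs → tally f (filterᵇ p xs) ≡ tally (λ x → ⟦ p x ⟧ * f x) xs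
  tally-filterᵇ p f []       = refl
  tally-filterᵇ p f (x ∷ xs) with p x
  ... | true  = cong₂ _+_ (sym (+-identityʳ _)) (tally-filterᵇ p f xs)
  ... | false = tally-filterᵇ p f xs

tally-map : ∀ {A B : Set} (f : B → ℕ) (g : A → B) xs → tally f (List.map g xs) ≡ tally (f ∘ g) xs
tally-map f g []       = refl
tally-map f g (x ∷ xs) = cong (f (g x) +_) (tally-map f g xs)

tally-product : ∀ {A B C : Set} (f : C → ℕ) (g : A → B → C) xs ys →
                tally f (cartesianProductWith g xs ys) ≡ tally (λ x → tally (λ y → f (g x y)) ys) xs
tally-product f g []       ys = refl
tally-product f g (x ∷ xs) ys =
  trans (tally-++ f (List.map (g x) ys) _) (cong₂ _+_ (tally-map f (g x) ys) (tally-product f g xs ys))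

opaque
  unfolding ∑

  tally-allFin : ∀ {n} (f : Fin n → ℕ) → tally f (allFin n) ≡ ∑ f
  tally-allFin {n} f = trans (cong sumₗ (map-tabulate id f)) (go f)
    where
    go : ∀ {n} (f : Fin n → ℕ) → sumₗ (List.tabulate f) ≡ ∑ f
    go {zero}  f = refl
    go {suc n} f = cong (f zero +_) (go (f ∘ suc))

-- Counting edges

∑∑ : ∀ {n} → (Fin n → Fin n → ℕ) → ℕ
∑∑ f = ∑ λ u → ∑ λ v → f u v

∑∑-mono : ∀ {n} {f g : Fin n → Fin n → ℕ} → (∀ u v → f u v ≤ g u v) → ∑∑ f ≤ ∑∑ g
∑∑-mono f≤g = ∑-mono λ u → ∑-mono (f≤g u)

∑∑-+ : ∀ {n} (f g : Fin n → Fin n → ℕ) → ∑∑ (λ u v → f u v + g u v) ≡ ∑∑ f + ∑∑ g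
∑∑-+ f g = trans (∑-cong (λ u → ∑-+ (f u) (g u))) (∑-+ (λ u → ∑ (f u)) (λ u → ∑ (g u)))

term≤∑∑ : ∀ {n} (f : Fin n → Fin n → ℕ) u v → f u v ≤ ∑∑ f
term≤∑∑ f u v = ≤-trans (term≤∑ (f u) v) (term≤∑ (λ u → ∑ (f u)) u)

arcs : ∀ {n} → Graph n → ℕ
arcs G = ∑∑ λ u v → ⟦ edge G u v ⟧

count-pairs : ∀ {n} (p : Fin n → Fin n → Bool) →
  length (filterᵇ (λ (u , v) → p u v) (pairs n)) ≡ ∑∑ (λ u v → ⟦ toℕ u <ᵇ toℕ v ⟧ * ⟦ p u v ⟧)
count-pairs {n} p = begin
  length (filterᵇ p′ (pairs n))                ≡⟨ length-filter≡tally _ (pairs n) ⟩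
  tally (λ x → ⟦ p′ x ⟧) (pairs n)             ≡⟨ tally-filterᵇ _ (λ x → ⟦ p′ x ⟧) (cartesianProduct (allFin n) (allFin n)) ⟩
  tally f (cartesianProduct (allFin n) (allFin n)) ≡⟨ tally-product f _,_ (allFin n) (allFin n) ⟩
  tally (λ u → tally (λ v → f (u , v)) (allFin n)) (allFin n) ≡⟨ tally-cong (λ u → tally-allFin λ v → f (u , v)) (allFin n) ⟩
  tally (λ u → ∑ (λ v → f (u , v))) (allFin n) ≡⟨ tally-allFin {n} _ ⟩
  ∑∑ (λ u v → f (u , v))                       ∎
  where
  open ≡-Reasoning
  p′ : Fin n × Fin n → Bool
  p′ (u , v) = p u v
  f : Fin n × Fin n → ℕ
  f (u , v) = ⟦ toℕ u <ᵇ toℕ v ⟧ * ⟦ p u v ⟧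

-- Passing to ordered pairs wastes a factor 2, which the constants absorb, and makes all later edge
-- counts symmetric double sums.
editDistance≤ : ∀ {n} (G G′ : Graph n) → editDistance G G′ ≤ ∑∑ (λ u v → ⟦ edge G u v xor edge G′ u v ⟧)
editDistance≤ G G′ = ≤-trans (≤-reflexive (count-pairs (λ u v → edge G u v xor edge G′ u v)))
  (∑∑-mono λ u v → ≤-trans (*-monoˡ-≤ _ (⟦⟧≤1 (toℕ u <ᵇ toℕ v))) (≤-reflexive (*-identityˡ _)))

T⇒≡true : ∀ {x} → T x → x ≡ true
T⇒≡true {true} _ = refl

arcs≤2edges : ∀ {n} (G : Graph n) → arcs G ≤ 2 * edgeCount G
arcs≤2edges {n} G = begin
  arcs G                           ≤⟨ ∑∑-mono split ⟩
  ∑∑ (λ u v → up u v + up v u)     ≡⟨ ∑∑-+ up (λ u v → up v u) ⟩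
  ∑∑ up + ∑∑ (λ u v → up v u)      ≡⟨ cong (∑∑ up +_) (∑-comm (λ u v → up v u)) ⟩
  ∑∑ up + ∑∑ up                    ≡⟨ cong₂ _+_ (sym (count-pairs (edge G))) (trans (sym (count-pairs (edge G))) (sym (+-identityʳ _))) ⟩
  2 * edgeCount G                  ∎
  where
  open ≤-Reasoning
  up : Fin n → Fin n → ℕ
  up u v = ⟦ toℕ u <ᵇ toℕ v ⟧ * ⟦ edge G u v ⟧
  split : ∀ u v → ⟦ edge G u v ⟧ ≤ up u v + up v u
  split u v with <-cmp (toℕ u) (toℕ v)
  ... | tri< u<v _ _ rewrite T⇒≡true (<⇒<ᵇ u<v) = ≤-trans (≤-reflexive (sym (+-identityʳ _))) (m≤m+n _ _)
  ... | tri> _ _ v<u rewrite T⇒≡true (<⇒<ᵇ v<u) | symm G u v = ≤-trans (≤-reflexive (sym (+-identityʳ _))) (m≤n+m _ (⟦ toℕ u <ᵇ toℕ v ⟧ * ⟦ edge G v u ⟧))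
  ... | tri≈ _ u≡v _ rewrite Fin.toℕ-injective u≡v | irrefl G v = z≤n

edge⇒0<edgeCount : ∀ {n} (G : Graph n) u v → T (edge G u v) → 0 < edgeCount G
edge⇒0<edgeCount G u v uv with edgeCount G | ≤-trans (≤-reflexive (sym (T⇒⟦⟧ uv))) (≤-trans (term≤∑∑ (λ u v → ⟦ edge G u v ⟧) u v) (arcs≤2edges G))
... | suc _ | _ = z<s

-- Cliques and containment of complete graphs

any-vec? : ∀ {A : Set} → (∀ {P : A → Set} → Decidable P → Dec (∃ P)) →
           ∀ k {P : Vec A k → Set} → Decidable P → Dec (∃ P)
any-vec? any zero    P? = map′ ([] ,_) (λ { ([] , p) → p }) (P? [])
any-vec? any (suc k) P? =
  map′ (λ (x , xs , p) → x ∷ xs , p) (λ { (x ∷ xs , p) → x , xs , p })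
       (any λ x → any-vec? any k λ xs → P? (x ∷ xs))

Clique : ∀ {s n} → Graph n → (Fin s → Fin n) → Set
Clique G φ = ∀ i j → i ≢ j → T (edge G (φ i) (φ j))

clique? : ∀ s {n} (G : Graph n) → Dec (∃ λ (z : Vec (Fin n) s) → Clique G (lookup z))
clique? s G = any-vec? Fin.any? s λ z →
  Fin.all? λ i → Fin.all? λ j → ¬? (i Fin.≟ j) →-dec T? (edge G (lookup z i) (lookup z j))

edge⇒≢ : ∀ {n} (G : Graph n) {u v} → T (edge G u v) → u ≢ v
edge⇒≢ G {u} uu refl = subst T (irrefl G u) uu

clique-injective : ∀ {s n} (G : Graph n) {φ : Fin s → Fin n} → Clique G φ → ∀ {i j} → φ i ≡ φ j → i ≡ j
clique-injective G cl {i} {j} φi≡φj with i Fin.≟ j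
... | yes i≡j = i≡j
... | no  i≢j = contradiction φi≡φj (edge⇒≢ G (cl i j i≢j))

K-edge⇒≢ : ∀ {s} {i j : Fin s} → T (edge (K s) i j) → i ≢ j
K-edge⇒≢ {i = i} {j} ij with i Fin.≟ j
... | no i≢j = i≢j

≢⇒K-edge : ∀ {s} {i j : Fin s} → i ≢ j → T (edge (K s) i j)
≢⇒K-edge {i = i} {j} i≢j with i Fin.≟ j
... | yes i≡j = i≢j i≡j
... | no  _   = _

clique⇒⊑ : ∀ {s n} (G : Graph n) {φ : Fin s → Fin n} → Clique G φ → K s ⊑ G
clique⇒⊑ G {φ} cl = φ , clique-injective G cl , λ i j ij → cl i j (K-edge⇒≢ ij)

⊑⇒clique : ∀ {s n} (G : Graph n) → K s ⊑ G → ∃ λ (z : Vec (Fin n) s) → Clique G (lookup z)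
⊑⇒clique G (φ , _ , hom) = tabulate φ , λ i j i≢j →
  subst₂ (λ u v → T (edge G u v)) (sym (Vec.lookup∘tabulate φ i)) (sym (Vec.lookup∘tabulate φ j)) (hom i j (≢⇒K-edge i≢j))

-- Packings of edge-disjoint cliques

-- For cliques, having no common edge means having at most one common vertex; in this form no edge
-- has to be mentioned.
EdgeDisjoint : ∀ {s n} → (φ ψ : Fin s → Fin n) → Set
EdgeDisjoint φ ψ = ∀ i i′ j j′ → φ i ≡ ψ j → φ i′ ≡ ψ j′ → φ i ≡ φ i′

EdgeDisjoint-sym : ∀ {s n} (φ ψ : Fin s → Fin n) → EdgeDisjoint φ ψ → EdgeDisjoint ψ φ
EdgeDisjoint-sym φ ψ disj i i′ j j′ e e′ = trans e (trans (disj j j′ i i′ (sym e) (sym e′)) (sym e′))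

_⊆_ : ∀ {n} → Graph n → Graph n → Set
H ⊆ G = ∀ u v → T (edge H u v) → T (edge G u v)

restrict : ∀ {n} (G : Graph n) (p : Fin n → Fin n → Bool) → (∀ u v → p u v ≡ p v u) → Graph n
restrict G p p-sym = record
  { edge   = λ u v → edge G u v ∧ p u v
  ; symm   = λ u v → cong₂ _∧_ (symm G u v) (p-sym u v)
  ; irrefl = λ v → cong (_∧ p v v) (irrefl G v)
  }

T-∧ˡ : ∀ {x y} → T (x ∧ y) → T x
T-∧ˡ {true} _ = _

T-∧ʳ : ∀ {x y} → T (x ∧ y) → T y
T-∧ʳ {true} t = t

restrict⊆ : ∀ {n} (G : Graph n) p p-sym → restrict G p p-sym ⊆ G
restrict⊆ G p p-sym u v = T-∧ˡ

arcs-restrict : ∀ {n} (G : Graph n) p p-sym →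
  arcs G ≤ arcs (restrict G p p-sym) + ∑∑ (λ u v → ⟦ edge G u v ∧ not (p u v) ⟧)
arcs-restrict G p p-sym = ≤-reflexive (trans
  (∑-cong λ u → ∑-cong λ v → split (edge G u v) (p u v))
  (∑∑-+ (λ u v → ⟦ edge G u v ∧ p u v ⟧) (λ u v → ⟦ edge G u v ∧ not (p u v) ⟧)))
  where
  split : ∀ x y → ⟦ x ⟧ ≡ ⟦ x ∧ y ⟧ + ⟦ x ∧ not y ⟧
  split true  true  = refl
  split true  false = refl
  split false _     = refl

image? : ∀ {s n} (φ : Fin s → Fin n) u → Dec (∃ λ i → φ i ≡ u)
image? φ u = Fin.any? λ i → φ i Fin.≟ u

both : ∀ {s n} (φ : Fin s → Fin n) → Fin n → Fin n → Bool
both φ u v = does (image? φ u) ∧ does (image? φ v)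

both-sym : ∀ {s n} (φ : Fin s → Fin n) u v → both φ u v ≡ both φ v u
both-sym φ u v = Bool.∧-comm (does (image? φ u)) (does (image? φ v))

remove : ∀ {s n} → Graph n → (Fin s → Fin n) → Graph n
remove G φ = restrict G (λ u v → not (both φ u v)) (λ u v → cong not (both-sym φ u v))

remove⊆ : ∀ {s n} (G : Graph n) (φ : Fin s → Fin n) → remove G φ ⊆ G
remove⊆ G φ u v = T-∧ˡ

image-size : ∀ {s n} (φ : Fin s → Fin n) → ∑ (λ u → ⟦ does (image? φ u) ⟧) ≤ s
image-size {s} φ = begin
  ∑ (λ u → ⟦ does (image? φ u) ⟧)                ≤⟨ ∑-mono cover ⟩
  ∑ (λ u → ∑ (λ i → ⟦ does (φ i Fin.≟ u) ⟧))     ≡⟨ ∑-comm (λ u i → ⟦ does (φ i Fin.≟ u) ⟧) ⟩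
  ∑ (λ i → ∑ (λ u → ⟦ does (φ i Fin.≟ u) ⟧))     ≡⟨ ∑-cong (λ i → ∑-indicator (φ i)) ⟩
  ∑ {s} (λ i → 1)                                ≡⟨ trans (∑-const s 1) (*-identityʳ s) ⟩
  s                                              ∎
  where
  open ≤-Reasoning
  cover : ∀ u → ⟦ does (image? φ u) ⟧ ≤ ∑ (λ i → ⟦ does (φ i Fin.≟ u) ⟧)
  cover u with image? φ u
  ... | no  _ = z≤n
  ... | yes (i , φi≡u) = ≤-trans (≤-reflexive (sym (hit i φi≡u))) (term≤∑ _ i)
    where
    hit : ∀ i → φ i ≡ u → ⟦ does (φ i Fin.≟ u) ⟧ ≡ 1
    hit i eq with φ i Fin.≟ u
    ... | yes _  = refl
    ... | no neq = contradiction eq neq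

T-not⇒¬ : ∀ {x} → T (not x) → ¬ T x
T-not⇒¬ {false} _ ()

T-does : ∀ {P : Set} (P? : Dec P) → P → T (does P?)
T-does (yes _) _ = _
T-does (no ¬p) p = ¬p p

T-∧ : ∀ {x y} → T x → T y → T (x ∧ y)
T-∧ {true} _ t = t

remove-avoids : ∀ {s n} (G : Graph n) (φ : Fin s → Fin n) i j → ¬ T (edge (remove G φ) (φ i) (φ j))
remove-avoids G φ i j t = T-not⇒¬ (T-∧ʳ {edge G (φ i) (φ j)} t)
  (T-∧ (T-does (image? φ (φ i)) (i , refl)) (T-does (image? φ (φ j)) (j , refl)))

-- Only arcs with both ends in the image disappear, and the image has at most `s` vertices.
arcs-remove : ∀ {s n} (G : Graph n) (φ : Fin s → Fin n) → arcs G ≤ arcs (remove G φ) + s * s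
arcs-remove {s} G φ = ≤-trans (arcs-restrict G (λ u v → not (both φ u v)) (λ u v → cong not (both-sym φ u v))) (+-monoʳ-≤ (arcs (remove G φ)) (begin
  ∑∑ (λ u v → ⟦ edge G u v ∧ not (not (both φ u v)) ⟧)                    ≤⟨ ∑∑-mono weaken ⟩
  ∑∑ (λ u v → ⟦ does (image? φ u) ⟧ * ⟦ does (image? φ v) ⟧)              ≡⟨ ∑-* (λ u → ⟦ does (image? φ u) ⟧) (λ u → ⟦ does (image? φ u) ⟧) ⟩
  ∑ (λ u → ⟦ does (image? φ u) ⟧) * ∑ (λ u → ⟦ does (image? φ u) ⟧)       ≤⟨ *-mono-≤ (image-size φ) (image-size φ) ⟩
  s * s                                                                   ∎))
  where
  open ≤-Reasoning
  bound : ∀ x y z → ⟦ x ∧ not (not (y ∧ z)) ⟧ ≤ ⟦ y ⟧ * ⟦ z ⟧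
  bound false _     _     = z≤n
  bound true  false _     = z≤n
  bound true  true  true  = ≤-refl
  bound true  true  false = z≤n
  weaken : ∀ u v → ⟦ edge G u v ∧ not (not (both φ u v)) ⟧ ≤ ⟦ does (image? φ u) ⟧ * ⟦ does (image? φ v) ⟧
  weaken u v = bound (edge G u v) (does (image? φ u)) (does (image? φ v))

⊆⇒⟦⟧≤ : ∀ {x y} → (T x → T y) → ⟦ x ⟧ ≤ ⟦ y ⟧
⊆⇒⟦⟧≤ {true}  {true}  f = ≤-refl
⊆⇒⟦⟧≤ {true}  {false} f = ⊥-elim (f _)
⊆⇒⟦⟧≤ {false} f = z≤n

arcs-strict : ∀ {n} (H G : Graph n) → H ⊆ G → ∀ u v → T (edge G u v) → ¬ T (edge H u v) → arcs H < arcs G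
arcs-strict H G H⊆G u v uv ¬uv =
  ∑-strict (λ u → ∑-mono λ v → ⊆⇒⟦⟧≤ (H⊆G u v)) u
    (∑-strict (λ v → ⊆⇒⟦⟧≤ (H⊆G u v)) v (strict ¬uv uv))
  where
  strict : ∀ {x y} → ¬ T x → T y → ⟦ x ⟧ < ⟦ y ⟧
  strict {true}  {_}    ¬x _ = contradiction _ ¬x
  strict {false} {true} _  _ = z<s

record Packing (s : ℕ) {n} (G : Graph n) : Set where
  field
    size      : ℕ
    member    : Fin size → Fin s → Fin n
    clique    : ∀ a → Clique G (member a)
    disjoint  : ∀ a b → a ≢ b → EdgeDisjoint (member a) (member b)
    rest      : Graph n
    rest⊆     : rest ⊆ G
    rest-free : (K s -Free) rest
    loss      : arcs G ≤ arcs rest + size * (s * s)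

-- Greedy choice: while a clique exists, take it and delete all edges inside its image. As `2 ≤ s`,
-- at least one arc goes each time, so the number of arcs serves as fuel.
pack : ∀ {s n} → 2 ≤ s → ∀ fuel (G : Graph n) → arcs G ≤ fuel → Packing s G
pack {s} 2≤s fuel G bound with clique? s G
... | no ¬cl = record
  { size      = 0
  ; member    = λ ()
  ; clique    = λ ()
  ; disjoint  = λ ()
  ; rest      = G
  ; rest⊆     = λ u v uv → uv
  ; rest-free = ¬cl ∘ ⊑⇒clique G
  ; loss      = m≤m+n (arcs G) 0
  }
pack {s@(suc (suc _))} (s≤s (s≤s _)) fuel G bound | yes (z , cl)
  with fuel | ≤-trans (arcs-strict (remove G (lookup z)) G (remove⊆ G (lookup z)) _ _ (cl zero (suc zero) λ ())
                        (remove-avoids G (lookup z) zero (suc zero))) bound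
... | suc fuel′ | s≤s bound′ = record
  { size      = suc size
  ; member    = λ { zero → φ ; (suc a) → member a }
  ; clique    = λ { zero → cl ; (suc a) i j i≢j → remove⊆ G φ _ _ (clique a i j i≢j) }
  ; disjoint  = λ { zero    zero    a≢a → contradiction refl a≢a
                  ; zero    (suc b) _   → EdgeDisjoint-sym (member b) φ (later b)
                  ; (suc a) zero    _   → later a
                  ; (suc a) (suc b) a≢b → disjoint a b (a≢b ∘ cong suc)
                  }
  ; rest      = rest
  ; rest⊆     = λ u v uv → remove⊆ G φ u v (rest⊆ u v uv)
  ; rest-free = rest-free
  ; loss      = total
  }
  where
  φ = lookup z
  open Packing (pack (s≤s (s≤s z≤n)) fuel′ (remove G φ) bound′)
  later : ∀ a → EdgeDisjoint (member a) φ
  -- Two different common vertices would be joined in `remove G φ`, which has no edge inside the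
  -- image of `φ`.
  later a i i′ j j′ e e′ with i Fin.≟ i′
  ... | yes refl = refl
  ... | no  i≢i′ = contradiction
    (subst₂ (λ u v → T (edge (remove G φ) u v)) e e′ (clique a i i′ i≢i′)) (remove-avoids G φ j j′)
  open ≤-Reasoning
  total : arcs G ≤ arcs rest + suc size * (s * s)
  total = begin
    arcs G                                     ≤⟨ arcs-remove G φ ⟩
    arcs (remove G φ) + s * s                  ≤⟨ +-monoˡ-≤ (s * s) loss ⟩
    arcs rest + size * (s * s) + s * s         ≡⟨ +-assoc (arcs rest) _ _ ⟩
    arcs rest + (size * (s * s) + s * s)       ≡⟨ cong (arcs rest +_) (+-comm (size * (s * s)) _) ⟩
    arcs rest + suc size * (s * s)             ∎

-- Probabilities from counts

/-mono-≤ : ∀ a b c d .{{_ : NonZero b}} .{{_ : NonZero d}} → a * d ≤ c * b → ℤ.+ a ℚ./ b ℚ.≤ ℤ.+ c ℚ./ d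
/-mono-≤ a b@(suc b-1) c d@(suc d-1) ad≤cb = ℚ.toℚᵘ-cancel-≤ (ℚᵘ.≤-respˡ-≃ (ℚᵘ.≃-sym (ℚ.toℚᵘ-fromℚᵘ (ℚᵘ.mkℚᵘ (ℤ.+ a) b-1)))
  (ℚᵘ.≤-respʳ-≃ (ℚᵘ.≃-sym (ℚ.toℚᵘ-fromℚᵘ (ℚᵘ.mkℚᵘ (ℤ.+ c) d-1)))
    (ℚᵘ.*≤* (subst₂ ℤ._≤_ (ℤ.pos-* a d) (ℤ.pos-* c b) (ℤ.+≤+ ad≤cb)))))

n/n≡1 : ∀ n .{{_ : NonZero n}} → ℤ.+ n ℚ./ n ≡ 1ℚ
n/n≡1 n = ℚ.≤-antisym (/-mono-≤ n n 1 1 (≤-reflexive (*-comm n 1))) (/-mono-≤ 1 1 n n (≤-reflexive (*-comm 1 n)))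

module _ {n r} {P : Pred (Coins n r) 0ℓ} (P? : Decidable P) where

  private
    hits : ℕ
    hits = length (filter P? (outcomes n r))

    instance
      2^≢0 : NonZero (2 ^ (n * r))
      2^≢0 = m^n≢0 2 (n * r)

    all-hit : (∀ ω → P ω) → hits ≡ 2 ^ (n * r)
    all-hit all = trans (cong length (filter-all P? {outcomes n r} (All.tabulate λ {ω} _ → all ω)))
      (length-outcomes n r)

  Pr≥2/3 : 2 * 2 ^ (n * r) ≤ 3 * length (filter P? (outcomes n r)) → ℤ.+ 2 ℚ./ 3 ℚ.≤ Pr P?
  Pr≥2/3 bound = /-mono-≤ 2 3 hits (2 ^ (n * r)) (≤-trans bound (≤-reflexive (*-comm 3 hits)))

  Pr-certain : (∀ ω → P ω) → Pr P? ≡ 1ℚ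
  Pr-certain all = trans (cong (λ k → ℤ.+ k ℚ./ 2 ^ (n * r)) (all-hit all)) (n/n≡1 (2 ^ (n * r)))

  Pr-certain≥2/3 : (∀ ω → P ω) → ℤ.+ 2 ℚ./ 3 ℚ.≤ Pr P?
  Pr-certain≥2/3 all = Pr≥2/3 (subst (λ k → 2 * 2 ^ (n * r) ≤ 3 * k) (sym (all-hit all))
    (*-monoˡ-≤ (2 ^ (n * r)) (s≤s (s≤s (z≤n {1})))))

-- Cylinder events

-- The sequences enumerate a product space, over which a sum of products factors coordinate by
-- coordinate.
tally-sequences : ∀ {A : Set} (xs : List A) k (f : Fin k → A → ℕ) →
  tally (λ v → ∏ (λ i → f i (lookup v i))) (sequences xs k) ≡ ∏ (λ i → tally (f i) xs)
tally-sequences xs zero    f = trans (+-identityʳ _) (trans (∏-empty _) (sym (∏-empty _)))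
tally-sequences {A} xs (suc k) f = begin
  tally (λ v → ∏ (λ i → f i (lookup v i))) (sequences xs (suc k))
    ≡⟨ tally-product (λ v → ∏ (λ i → f i (lookup v i))) _∷_ xs (sequences xs k) ⟩
  tally (λ x → tally (λ v → ∏ (λ i → f i (lookup (x ∷ v) i))) (sequences xs k)) xs
    ≡⟨ tally-cong (λ x → tally-cong (λ v → ∏-suc (λ i → f i (lookup (x ∷ v) i))) (sequences xs k)) xs ⟩
  tally (λ x → tally (λ v → f zero x * tail v) (sequences xs k)) xs
    ≡⟨ tally-cong (λ x → tally-*ˡ (f zero x) tail (sequences xs k)) xs ⟩
  tally (λ x → f zero x * tally tail (sequences xs k)) xs
    ≡⟨ tally-*ʳ (tally tail (sequences xs k)) (f zero) xs ⟩
  tally (f zero) xs * tally tail (sequences xs k)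
    ≡⟨ cong (tally (f zero) xs *_) (tally-sequences xs k (f ∘ suc)) ⟩
  tally (f zero) xs * ∏ (λ i → tally (f (suc i)) xs)
    ≡⟨ ∏-suc (λ i → tally (f i) xs) ⟨
  ∏ (λ i → tally (f i) xs) ∎
  where
  open ≡-Reasoning
  tail : Vec A k → ℕ
  tail v = ∏ (λ i → f (suc i) (lookup v i))

∏∏ : ∀ {n r} → (Fin n → Fin r → ℕ) → ℕ
∏∏ f = ∏ λ v → ∏ λ p → f v p

∏∏-* : ∀ {n r} (f g : Fin n → Fin r → ℕ) → ∏∏ (λ v p → f v p * g v p) ≡ ∏∏ f * ∏∏ g
∏∏-* f g = trans (∏-cong λ v → ∏-* (f v) (g v)) (∏-* (λ v → ∏ (f v)) (λ v → ∏ (g v)))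

∏∏-cong : ∀ {n r} {f g : Fin n → Fin r → ℕ} → (∀ v p → f v p ≡ g v p) → ∏∏ f ≡ ∏∏ g
∏∏-cong f≗g = ∏-cong λ v → ∏-cong (f≗g v)

∏∏-2 : ∀ n r → ∏∏ {n} {r} (λ _ _ → 2) ≡ 2 ^ (n * r)
∏∏-2 n r = begin
  ∏ {n} (λ _ → ∏ {r} (λ _ → 2)) ≡⟨ ∏-cong (λ _ → ∏-const r 2) ⟩
  ∏ {n} (λ _ → 2 ^ r)           ≡⟨ ∏-const n (2 ^ r) ⟩
  (2 ^ r) ^ n                   ≡⟨ ^-*-assoc 2 r n ⟩
  2 ^ (r * n)                   ≡⟨ cong (2 ^_) (*-comm r n) ⟩
  2 ^ (n * r)                   ∎
  where open ≡-Reasoning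

tally-outcomes : ∀ {n r} (f : Fin n → Fin r → Bool → ℕ) →
  tally (λ ω → ∏∏ (λ v p → f v p (lookup (lookup ω v) p))) (outcomes n r) ≡
  ∏∏ (λ v p → f v p true + f v p false)
tally-outcomes {n} {r} f = trans
  (tally-sequences _ n (λ v bits → ∏ (λ p → f v p (lookup bits p))))
  (∏-cong λ v → trans (tally-sequences _ r (f v))
    (∏-cong λ p → cong (f v p true +_) (+-identityʳ _)))

-- `nothing` leaves a coin unconstrained.
Cylinder : ℕ → ℕ → Set
Cylinder n r = Fin n → Fin r → Maybe Bool

χ : Maybe Bool → Bool → ℕ
χ nothing  y = 1
χ (just x) y = ⟦ does (x Bool.≟ y) ⟧

indicator : ∀ {n r} → Cylinder n r → Coins n r → ℕ
indicator c ω = ∏∏ λ v p → χ (c v p) (lookup (lookup ω v) p)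

choices : Maybe Bool → ℕ
choices m = χ m true + χ m false

volume : ∀ {n r} → Cylinder n r → ℕ
volume c = ∏∏ λ v p → choices (c v p)

tally-indicator : ∀ {n r} (c : Cylinder n r) → tally (indicator c) (outcomes n r) ≡ volume c
tally-indicator c = tally-outcomes (λ v p → χ (c v p))

χ²≤χ : ∀ m y → χ m y * χ m y ≤ χ m y
χ²≤χ nothing  y = ≤-refl
χ²≤χ (just x) y with x Bool.≟ y
... | yes _ = ≤-refl
... | no  _ = ≤-refl

indicator² : ∀ {n r} (c : Cylinder n r) ω → indicator c ω * indicator c ω ≤ indicator c ω
indicator² c ω = ≤-trans (≤-reflexive (sym (∏∏-* _ _))) (∏-mono λ v → ∏-mono λ p → χ²≤χ (c v p) _)

Fits : Maybe Bool → Bool → Set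
Fits m y = 0 < χ m y

fits? : ∀ m y → Dec (Fits m y)
fits? m y = 0 <? χ m y

indicator⇒fits : ∀ {n r} (c : Cylinder n r) ω → 0 < indicator c ω → ∀ v p → Fits (c v p) (lookup (lookup ω v) p)
indicator⇒fits c ω 0<ind v p = ∏>0⇒ _ (∏>0⇒ _ 0<ind v) p

Independent Conflicting : ∀ {n r} → Cylinder n r → Cylinder n r → Set
Independent c c′ = ∀ v p → c v p ≡ nothing ⊎ c′ v p ≡ nothing
Conflicting c c′ = ∃₂ λ v p → ∃₂ λ x x′ → c v p ≡ just x × c′ v p ≡ just x′ × x ≢ x′

module _ {n r} (c c′ : Cylinder n r) where

  private
    joint : ℕ
    joint = tally (λ ω → indicator c ω * indicator c′ ω) (outcomes n r)

    agreeing : Maybe Bool → Maybe Bool → ℕ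
    agreeing m m′ = χ m true * χ m′ true + χ m false * χ m′ false

    joint≡ : joint ≡ ∏∏ (λ v p → agreeing (c v p) (c′ v p))
    joint≡ = trans (tally-cong (λ ω → sym (∏∏-* _ _)) (outcomes n r))
      (tally-outcomes (λ v p y → χ (c v p) y * χ (c′ v p) y))

    agreeing-free : ∀ m m′ → m ≡ nothing ⊎ m′ ≡ nothing → agreeing m m′ * 2 ≡ choices m * choices m′
    agreeing-free nothing m′ _ = lemma (χ m′ true) (χ m′ false)
      where
      lemma : ∀ a b → (1 * a + 1 * b) * 2 ≡ 2 * (a + b)
      lemma = solve-∀
    agreeing-free (just x) nothing _ = lemma (χ (just x) true) (χ (just x) false)
      where
      lemma : ∀ a b → (a * 1 + b * 1) * 2 ≡ (a + b) * 2
      lemma = solve-∀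
    agreeing-free (just x) (just x′) (inj₁ ())
    agreeing-free (just x) (just x′) (inj₂ ())

    agreeing-conflict : ∀ {x x′} → x ≢ x′ → agreeing (just x) (just x′) ≡ 0
    agreeing-conflict {true}  {true}  x≢x′ = contradiction refl x≢x′
    agreeing-conflict {true}  {false} x≢x′ = refl
    agreeing-conflict {false} {true}  x≢x′ = refl
    agreeing-conflict {false} {false} x≢x′ = contradiction refl x≢x′

  -- Both sides factor over the coins. At a coin that one cylinder leaves free, the count of
  -- agreeing values times 2 equals the product of the two counts of choices; a coin prescribed in
  -- two ways makes the joint count vanish.
  nonpositively-correlated : Independent c c′ ⊎ Conflicting c c′ →
    tally (λ ω → indicator c ω * indicator c′ ω) (outcomes n r) * 2 ^ (n * r) ≤ volume c * volume c′
  nonpositively-correlated (inj₁ free) = ≤-reflexive (begin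
    joint * 2 ^ (n * r)
      ≡⟨ cong₂ _*_ joint≡ (sym (∏∏-2 n r)) ⟩
    ∏∏ (λ v p → agreeing (c v p) (c′ v p)) * ∏∏ {n} {r} (λ _ _ → 2)
      ≡⟨ ∏∏-* (λ v p → agreeing (c v p) (c′ v p)) (λ _ _ → 2) ⟨
    ∏∏ (λ v p → agreeing (c v p) (c′ v p) * 2)
      ≡⟨ ∏∏-cong (λ v p → agreeing-free (c v p) (c′ v p) (free v p)) ⟩
    ∏∏ (λ v p → choices (c v p) * choices (c′ v p))
      ≡⟨ ∏∏-* (λ v p → choices (c v p)) (λ v p → choices (c′ v p)) ⟩
    volume c * volume c′ ∎)
    where open ≡-Reasoning
  nonpositively-correlated (inj₂ (v , p , x , x′ , eq , eq′ , x≢x′)) = ≤-trans (≤-reflexive zero!) z≤n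
    where
    zero! : joint * 2 ^ (n * r) ≡ 0
    zero! = cong (_* 2 ^ (n * r)) (trans joint≡ (∏-zero _ v (∏-zero _ p
      (trans (cong₂ agreeing eq eq′) (agreeing-conflict x≢x′)))))

cost : Maybe Bool → ℕ
cost nothing  = 1
cost (just _) = 2

volume*cost : ∀ {n r} (c : Cylinder n r) → volume c * ∏∏ (λ v p → cost (c v p)) ≡ 2 ^ (n * r)
volume*cost {n} {r} c = begin
  volume c * ∏∏ (λ v p → cost (c v p))          ≡⟨ ∏∏-* (λ v p → choices (c v p)) (λ v p → cost (c v p)) ⟨
  ∏∏ (λ v p → choices (c v p) * cost (c v p))   ≡⟨ ∏∏-cong (λ v p → two (c v p)) ⟩
  ∏∏ {n} {r} (λ _ _ → 2)                        ≡⟨ ∏∏-2 n r ⟩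
  2 ^ (n * r)                                   ∎
  where
  open ≡-Reasoning
  two : ∀ m → choices m * cost m ≡ 2
  two nothing      = refl
  two (just true)  = refl
  two (just false) = refl

-- The second moment method

2xy≤x²+y² : ∀ x y → 2 * (x * y) ≤ x * x + y * y
2xy≤x²+y² x y with ≤-total x y
... | inj₁ x≤y = subst (λ y → 2 * (x * y) ≤ x * x + y * y) (m+[n∸m]≡n x≤y)
    (≤-trans (m≤m+n _ ((y ∸ x) * (y ∸ x))) (≤-reflexive (square x (y ∸ x))))
  where
  square : ∀ x d → 2 * (x * (x + d)) + d * d ≡ x * x + (x + d) * (x + d)
  square = solve-∀
... | inj₂ y≤x = subst (λ x → 2 * (x * y) ≤ x * x + y * y) (m+[n∸m]≡n y≤x)
    (≤-trans (m≤m+n _ ((x ∸ y) * (x ∸ y))) (≤-reflexive (square y (x ∸ y))))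
  where
  square : ∀ y d → 2 * ((y + d) * y) + d * d ≡ (y + d) * (y + d) + y * y
  square = solve-∀

module _ {n r k} (c : Fin k → Cylinder n r)
         (correlation : ∀ a b → a ≢ b →
           tally (λ ω → indicator (c a) ω * indicator (c b) ω) (outcomes n r) * 2 ^ (n * r) ≤ volume (c a) * volume (c b))
         {P : Pred (Coins n r) 0ℓ} (P? : Decidable P)
         (covers : ∀ a ω → 0 < indicator (c a) ω → P ω) where

  private
    M S W : ℕ
    M = 2 ^ (n * r)
    S = ∑ λ a → volume (c a)
    W = tally (λ ω → ⟦ does (P? ω) ⟧) (outcomes n r)

    X : Coins n r → ℕ
    X ω = ∑ λ a → indicator (c a) ω

    first-moment : tally X (outcomes n r) ≡ S
    first-moment = trans (tally-∑ (λ a → indicator (c a)) (outcomes n r)) (∑-cong λ a → tally-indicator (c a))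

    both-moment : Fin k → Fin k → ℕ
    both-moment a b = tally (λ ω → indicator (c a) ω * indicator (c b) ω) (outcomes n r)

    second-moment≡ : tally (λ ω → X ω * X ω) (outcomes n r) ≡ ∑∑ both-moment
    second-moment≡ = begin
      tally (λ ω → X ω * X ω) (outcomes n r)
        ≡⟨ tally-cong (λ ω → sym (∑-* (λ a → indicator (c a) ω) (λ a → indicator (c a) ω))) (outcomes n r) ⟩
      tally (λ ω → ∑ λ a → ∑ λ b → indicator (c a) ω * indicator (c b) ω) (outcomes n r)
        ≡⟨ tally-∑ (λ a ω → ∑ λ b → indicator (c a) ω * indicator (c b) ω) (outcomes n r) ⟩
      ∑ (λ a → tally (λ ω → ∑ λ b → indicator (c a) ω * indicator (c b) ω) (outcomes n r))
        ≡⟨ ∑-cong (λ a → tally-∑ (λ b ω → indicator (c a) ω * indicator (c b) ω) (outcomes n r)) ⟩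
      ∑∑ both-moment ∎
      where open ≡-Reasoning

    pairwise : ∀ a b → both-moment a b * M ≤ volume (c a) * volume (c b) + volume (c a) * M * ⟦ does (a Fin.≟ b) ⟧
    pairwise a b with a Fin.≟ b
    ... | no a≢b  = ≤-trans (correlation a b a≢b) (m≤m+n _ _)
    ... | yes refl = ≤-trans (*-monoˡ-≤ M (≤-trans (tally-mono (indicator² (c a)) (outcomes n r)) (≤-reflexive (tally-indicator (c a)))))
        (≤-trans (≤-reflexive (sym (*-identityʳ _))) (m≤n+m _ (volume (c a) * volume (c a))))

    -- Off the diagonal the correlation hypothesis applies; on it the square of an indicator is at
    -- most the indicator, which contributes the term `S * M`.
    second-moment : tally (λ ω → X ω * X ω) (outcomes n r) * M ≤ S * S + S * M
    second-moment = begin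
      tally (λ ω → X ω * X ω) (outcomes n r) * M
        ≡⟨ cong (_* M) second-moment≡ ⟩
      ∑∑ both-moment * M
        ≡⟨ trans (*-distribʳ-∑ M (λ a → ∑ (both-moment a))) (∑-cong λ a → *-distribʳ-∑ M (both-moment a)) ⟩
      ∑∑ (λ a b → both-moment a b * M)
        ≤⟨ ∑∑-mono pairwise ⟩
      ∑∑ (λ a b → volume (c a) * volume (c b) + volume (c a) * M * ⟦ does (a Fin.≟ b) ⟧)
        ≡⟨ ∑∑-+ (λ a b → volume (c a) * volume (c b)) (λ a b → volume (c a) * M * ⟦ does (a Fin.≟ b) ⟧) ⟩
      ∑∑ (λ a b → volume (c a) * volume (c b)) + ∑∑ (λ a b → volume (c a) * M * ⟦ does (a Fin.≟ b) ⟧)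
        ≡⟨ cong₂ _+_ (∑-* (λ a → volume (c a)) (λ a → volume (c a))) diagonal ⟩
      S * S + S * M ∎
      where
      open ≤-Reasoning
      diagonal : ∑∑ (λ a b → volume (c a) * M * ⟦ does (a Fin.≟ b) ⟧) ≡ S * M
      diagonal = trans
        (∑-cong λ a → trans (sym (*-distribˡ-∑ (volume (c a) * M) (λ b → ⟦ does (a Fin.≟ b) ⟧)))
          (trans (cong (volume (c a) * M *_) (∑-indicator a)) (*-identityʳ _)))
        (sym (*-distribʳ-∑ M (λ a → volume (c a))))

    -- AM–GM for A = S + M and M · X, weighted by the indicator of P.
    pointwise : ∀ ω → 2 * (S + M) * M * X ω ≤ (S + M) * (S + M) * ⟦ does (P? ω) ⟧ + M * M * (X ω * X ω)
    pointwise ω with P? ω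
    ... | yes _ = subst₂ _≤_ (lhs (S + M) M (X ω)) (rhs (S + M) M (X ω)) (2xy≤x²+y² (S + M) (M * X ω))
      where
      lhs : ∀ A B x → 2 * (A * (B * x)) ≡ 2 * A * B * x
      lhs = solve-∀
      rhs : ∀ A B x → A * A + B * x * (B * x) ≡ A * A * 1 + B * B * (x * x)
      rhs = solve-∀
    ... | no ¬Pω with X ω in eq
    ...   | zero  = ≤-trans (≤-reflexive (*-zeroʳ (2 * (S + M) * M))) z≤n
    ...   | suc _ with a , 0<ind ← ∑>0⇒∃ (λ a → indicator (c a) ω) (subst (0 <_) (sym eq) z<s) =
      contradiction (covers a ω 0<ind) ¬Pω

    Y : ℕ
    Y = tally (λ ω → X ω * X ω) (outcomes n r)

    summed : 2 * (S + M) * M * S ≤ (S + M) * (S + M) * W + M * M * Y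
    summed = begin
      2 * (S + M) * M * S
        ≡⟨ cong (2 * (S + M) * M *_) (sym first-moment) ⟩
      2 * (S + M) * M * tally X Ω
        ≡⟨ tally-*ˡ (2 * (S + M) * M) X Ω ⟨
      tally (λ ω → 2 * (S + M) * M * X ω) Ω
        ≤⟨ tally-mono pointwise Ω ⟩
      tally (λ ω → (S + M) * (S + M) * ⟦ does (P? ω) ⟧ + M * M * (X ω * X ω)) Ω
        ≡⟨ tally-+ _ _ Ω ⟩
      tally (λ ω → (S + M) * (S + M) * ⟦ does (P? ω) ⟧) Ω + tally (λ ω → M * M * (X ω * X ω)) Ω
        ≡⟨ cong₂ _+_ (tally-*ˡ ((S + M) * (S + M)) _ Ω) (tally-*ˡ (M * M) _ Ω) ⟩
      (S + M) * (S + M) * W + M * M * Y ∎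
      where
      open ≤-Reasoning
      Ω = outcomes n r

    SM>0 : NonZero (S + M)
    SM>0 = >-nonZero (≤-trans (m^n>0 2 (n * r)) (m≤n+m M S))

    -- With mean `μ = S / M` this says that `P` has probability at least `μ / (1 + μ)`. The weight
    -- `S + M` in AM-GM corresponds to `X = 1 + μ`, the ratio of the bound `μ * μ + μ` on the second
    -- moment to the first moment.
    MS≤ : M * S ≤ (S + M) * W
    MS≤ = +-cancelʳ-≤ (M * S) _ _ (*-cancelˡ-≤ (S + M) {{SM>0}} (begin
      (S + M) * (M * S + M * S)               ≡⟨ double (S + M) M S ⟩
      2 * (S + M) * M * S                     ≤⟨ summed ⟩
      (S + M) * (S + M) * W + M * M * Y       ≡⟨ cong (((S + M) * (S + M) * W) +_) (shuffle M Y) ⟩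
      (S + M) * (S + M) * W + M * (Y * M)     ≤⟨ +-monoʳ-≤ ((S + M) * (S + M) * W) (*-monoʳ-≤ M second-moment) ⟩
      (S + M) * (S + M) * W + M * (S * S + S * M) ≡⟨ factor S M W ⟩
      (S + M) * ((S + M) * W + M * S)         ∎))
      where
      open ≤-Reasoning
      double : ∀ A M S → A * (M * S + M * S) ≡ 2 * A * M * S
      double = solve-∀
      shuffle : ∀ M Y → M * M * Y ≡ M * (Y * M)
      shuffle = solve-∀
      factor : ∀ S M W → (S + M) * (S + M) * W + M * (S * S + S * M) ≡ (S + M) * ((S + M) * W + M * S)
      factor = solve-∀

  second-moment-method : 2 * 2 ^ (n * r) ≤ ∑ (λ a → volume (c a)) → ℤ.+ 2 ℚ./ 3 ℚ.≤ Pr P?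
  second-moment-method 2M≤S = Pr≥2/3 P? (subst (λ W → 2 * M ≤ 3 * W) (sym (length-filter≡tally P? (outcomes n r)))
    (*-cancelˡ-≤ (S + M) {{SM>0}} (begin
      (S + M) * (2 * M)       ≡⟨ expand S M ⟩
      2 * (M * S) + M * (2 * M) ≤⟨ +-monoʳ-≤ (2 * (M * S)) (*-monoʳ-≤ M 2M≤S) ⟩
      2 * (M * S) + M * S     ≡⟨ collect (M * S) ⟩
      3 * (M * S)             ≤⟨ *-monoʳ-≤ 3 MS≤ ⟩
      3 * ((S + M) * W)       ≡⟨ swap (S + M) W ⟩
      (S + M) * (3 * W)       ∎)))
    where
    open ≤-Reasoning
    expand : ∀ S M → (S + M) * (2 * M) ≡ 2 * (M * S) + M * (2 * M)
    expand = solve-∀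
    collect : ∀ x → 2 * x + x ≡ 3 * x
    collect = solve-∀
    swap : ∀ A W → 3 * (A * W) ≡ A * (3 * W)
    swap = solve-∀

-- Descent to a threshold, binary digits, message codes

module _ {P : ℕ → Set} (P? : Decidable P) where

  -- The descent stops just above the first failure it meets: success at the result and failure at
  -- its predecessor are what the address width and the number of blocks rely on.
  descend : ℕ → ℕ
  descend zero    = zero
  descend (suc k) with P? k
  ... | yes _ = descend k
  ... | no  _ = suc k

  descend-holds : ∀ k → P k → P (descend k)
  descend-holds zero    p = p
  descend-holds (suc k) p with P? k
  ... | yes q = descend-holds k q
  ... | no  _ = p

  descend-≤ : ∀ k → descend k ≤ k
  descend-≤ zero    = z≤n
  descend-≤ (suc k) with P? k
  ... | yes _ = m≤n⇒m≤1+n (descend-≤ k)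
  ... | no  _ = ≤-refl

  descend-minimal : ∀ k → descend k ≡ 0 ⊎ ∃ λ j → descend k ≡ suc j × ¬ P j
  descend-minimal zero    = inj₁ refl
  descend-minimal (suc k) with P? k
  ... | yes _ = descend-minimal k
  ... | no ¬p = inj₂ (k , refl , ¬p)

odd : ℕ → Bool
odd zero          = false
odd (suc zero)    = true
odd (suc (suc n)) = odd n

digit : ℕ → ℕ → Bool
digit zero    n = odd n
digit (suc l) n = digit l ⌊ n /2⌋

parity-split : ∀ n → n ≡ ⟦ odd n ⟧ + 2 * ⌊ n /2⌋
parity-split zero          = refl
parity-split (suc zero)    = refl
parity-split (suc (suc n)) = trans (cong (2 +_) (parity-split n)) (shift ⟦ odd n ⟧ ⌊ n /2⌋)
  where
  shift : ∀ a b → 2 + (a + 2 * b) ≡ a + 2 * suc b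
  shift = solve-∀

digits-injective : ∀ k m n → m < 2 ^ k → n < 2 ^ k → (∀ l → l < k → digit l m ≡ digit l n) → m ≡ n
digits-injective zero    m n m<1 n<1 _ = trans (n<1⇒n≡0 m<1) (sym (n<1⇒n≡0 n<1))
digits-injective (suc k) m n m< n< same = begin
  m                          ≡⟨ parity-split m ⟩
  ⟦ odd m ⟧ + 2 * ⌊ m /2⌋    ≡⟨ cong₂ (λ x y → ⟦ x ⟧ + 2 * y) (same 0 z<s) halves ⟩
  ⟦ odd n ⟧ + 2 * ⌊ n /2⌋    ≡⟨ parity-split n ⟨
  n                          ∎
  where
  open ≡-Reasoning
  half< : ∀ x → x < 2 ^ suc k → ⌊ x /2⌋ < 2 ^ k
  half< x x< = *-cancelˡ-< 2 _ _ (≤-<-trans (≤-trans (m≤n+m _ ⟦ odd x ⟧) (≤-reflexive (sym (parity-split x)))) x<)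
  halves : ⌊ m /2⌋ ≡ ⌊ n /2⌋
  halves = digits-injective k _ _ (half< m m<) (half< n n<) λ l l<k → same (suc l) (s<s l<k)

fits-just : ∀ {x y} → Fits (just x) y → x ≡ y
fits-just {x} {y} f with x Bool.≟ y
... | yes eq = eq

vectors-count : ∀ {n b} (f : Fin n → Vec Bool b) → Injective _≡_ _≡_ f → n ≤ 2 ^ b
vectors-count {n} {b} f inj = Fin.injective⇒≤ {f = code ∘ f} λ eq → inj (code-injective eq)
  where
  bool : Bool → Fin 2
  bool false = zero
  bool true  = suc zero
  bool-injective : ∀ {x y} → bool x ≡ bool y → x ≡ y
  bool-injective {false} {false} _ = refl
  bool-injective {true}  {true}  _ = refl
  code : Vec Bool b → Fin (2 ^ b)
  code v = funToFin (bool ∘ lookup v)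
  code-injective : ∀ {v w} → code v ≡ code w → v ≡ w
  code-injective {v} {w} eq = trans (sym (Vec.tabulate∘lookup v)) (trans (Vec.tabulate-cong λ l → bool-injective (begin
    bool (lookup v l)          ≡⟨ Fin.finToFun-funToFin (bool ∘ lookup v) l ⟨
    Fin.finToFun (code v) l    ≡⟨ cong (λ c → Fin.finToFun c l) eq ⟩
    Fin.finToFun (code w) l    ≡⟨ Fin.finToFun-funToFin (bool ∘ lookup w) l ⟩
    bool (lookup w l)          ∎)) (Vec.tabulate∘lookup w))
    where open ≡-Reasoning

decode : ∀ {b} → Message → Vec Bool b
decode {zero}  _        = []
decode {suc b} []       = false ∷ decode []
decode {suc b} (x ∷ xs) = x ∷ decode xs

decode-toList : ∀ {b} (v : Vec Bool b) → decode (toList v) ≡ v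
decode-toList []      = refl
decode-toList (x ∷ v) = cong (x ∷_) (decode-toList v)

flag : Message → Bool
flag []      = false
flag (x ∷ _) = x

body : ∀ {b} → Message → Vec Bool b
body []       = decode []
body (_ ∷ xs) = decode xs

-- The protocol

-- A node with d ports splits them into 1 + τ blocks of at most 2 ^ width d ports each.
-- For each of e roles and each block, its private coins spell the address of a uniformly
-- random position in the block; the port there, if any, is selected.
module Tester (e τ b : ℕ) where

  blocks slots coinCount rounds : ℕ
  blocks    = suc τ
  slots     = e * blocks
  coinCount = slots * b
  -- Round 0 exchanges identifiers, and answers lag one round behind the `slots` rounds of queries.
  rounds    = 2 + slots

  -- The search starts at `b` because distinct identifiers bound every degree by `2 ^ b`; an address
  -- thus fits into the `b` coins of a slot.
  width : ℕ → ℕ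
  width d = descend (λ k → d ≤? blocks * 2 ^ k) b

  module _ {d : ℕ} where

    block : Fin d → Fin blocks
    block i = toℕ i mod blocks

    -- The residue of a port number is its block and the quotient its position, spelled here in
    -- binary. Coins beyond the width stay free, so that a port is selected with probability
    -- `2 ^ width d` to the minus one rather than `2 ^ b` to the minus one.
    address : Fin d → Fin b → Maybe Bool
    address i l = if toℕ l <ᵇ width d then just (digit (toℕ l) (toℕ i / blocks)) else nothing

    -- A pair of a role and a block has its own coins, which makes the roles independent, and its
    -- own query round, which does not depend on the degree.
    slot : Fin e → Fin d → Fin slots
    slot j i = combine j (block i)

    Selected : Vec Bool coinCount → Fin e → Fin d → Set
    Selected bits j i = ∀ l → Fits (address i l) (lookup bits (combine (slot j i) l))

    selected? : ∀ bits j i → Dec (Selected bits j i)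
    selected? bits j i = Fin.all? λ l → fits? (address i l) _

  record State (d : ℕ) : Set where
    field
      me    : Vec Bool b
      bits  : Vec Bool coinCount
      clock : ℕ
      log   : ℕ → Fin d → Message

  open State

  module _ {d : ℕ} where

    ident-of : State d → Fin d → Vec Bool b
    ident-of st i = body (log st 0 i)

    Queried : State d → ℕ → Fin d → Set
    Queried st r i = ∃ λ j → toℕ (slot j i) ≡ r × Selected (bits st) j i

    queried? : ∀ st r → Dec (∃ (Queried st r))
    queried? st r = Fin.any? λ i → Fin.any? λ j → (toℕ (slot j i) ≟ r) ×-dec selected? (bits st) j i

    query : ℕ → State d → Vec Bool b
    query zero    st = me st
    query (suc r) st with queried? st r
    ... | yes (i , _) = ident-of st i
    -- A filler for a slot whose address is vacant; `Reject` consults only slots in which a port is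
    -- selected.
    ... | no  _       = me st

    adjacent? : ∀ (st : State d) (x : Vec Bool b) → Dec (∃ λ j → ident-of st j ≡ x)
    adjacent? st x = Fin.any? λ j → Vec.≡-dec Bool._≟_ (ident-of st j) x

    answer : ℕ → State d → Fin d → Bool
    answer zero    st i = false
    answer (suc r) st i = does (adjacent? st (body (log st r i)))

    -- The query for slot r is sent in round 1 + r and answered in round 2 + r.
    Reject : State d → Set
    Reject st = ∃ λ (z : Vec (Fin d) (suc e)) →
      (∀ j → Selected (bits st) j (lookup z (suc j))) ×
      (∀ j i → i ≢ suc j → T (flag (log st (2 + toℕ (slot j (lookup z (suc j)))) (lookup z i))))

    reject? : ∀ st → Dec (Reject st)
    reject? st = any-vec? Fin.any? (suc e) λ z →
      (Fin.all? λ j → selected? (bits st) j (lookup z (suc j))) ×-dec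
      (Fin.all? λ j → Fin.all? λ i → ¬? (i Fin.≟ suc j) →-dec
        T? (flag (log st (2 + toℕ (slot j (lookup z (suc j)))) (lookup z i))))

  decide : ∀ {d} → State d → Maybe Bool
  -- Isolated nodes accept at once, so an edgeless network halts in 0 rounds; they have no
  -- neighbours that could miss their messages.
  decide {zero}  st = just true
  decide {suc d} st = if clock st ≡ᵇ rounds then just (not (does (reject? st))) else nothing

  protocol : Protocol b
  protocol = record
    { coins   = coinCount
    ; State   = State
    ; init    = λ x d ω → record { me = x ; bits = ω ; clock = 0 ; log = λ _ _ → [] }
    ; send    = λ st i → answer (clock st) st i ∷ toList (query (clock st) st)
    ; receive = λ st msgs → record
        { me    = me st
        ; bits  = bits st
        ; clock = suc (clock st)
        ; log   = λ r → if r ≡ᵇ clock st then msgs else log st r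
        }
    ; verdict = decide
    }

  decide-running : ∀ {d} (st : State d) → Fin d → clock st < rounds → decide st ≡ nothing
  decide-running {suc d} st _ clock< with clock st ≡ᵇ rounds in eq
  ... | false = refl
  ... | true  = contradiction (≡ᵇ⇒≡ (clock st) rounds (subst T (sym eq) _)) (<⇒≢ clock<)

  decide-final : ∀ {d} (st : State d) → Fin d → clock st ≡ rounds → decide st ≡ just (not (does (reject? st)))
  decide-final {suc d} st _ refl with rounds ≡ᵇ rounds in eq
  ... | true  = refl
  ... | false = ⊥-elim (subst T eq (≡⇒≡ᵇ rounds rounds refl))

  address-width : ∀ {d} (i : Fin d) l → toℕ l < width d → address i l ≡ just (digit (toℕ l) (toℕ i / blocks))
  address-width {d} i l l<w with toℕ l <ᵇ width d in eq
  ... | true  = refl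
  ... | false = ⊥-elim (subst T eq (<⇒<ᵇ l<w))

  width-holds : ∀ {d} → d ≤ 2 ^ b → d ≤ blocks * 2 ^ width d
  width-holds {d} d≤ = descend-holds (λ k → d ≤? blocks * 2 ^ k) b (≤-trans d≤ (m≤m+n (2 ^ b) _))

  -- Quotient and remainder determine the port, and the quotient is below `2 ^ width d`, so its
  -- spelled digits determine it.
  address-injective : ∀ {d} → d ≤ 2 ^ b → (i i′ : Fin d) → block i ≡ block i′ →
                      (∀ l → address i l ≡ address i′ l) → i ≡ i′
  address-injective {d} d≤ i i′ same-block same-address = Fin.toℕ-injective (begin
    toℕ i                                     ≡⟨ m≡m%n+[m/n]*n (toℕ i) blocks ⟩
    toℕ i % blocks + toℕ i / blocks * blocks  ≡⟨ cong₂ (λ x y → x + y * blocks) remainders quotients ⟩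
    toℕ i′ % blocks + toℕ i′ / blocks * blocks ≡⟨ m≡m%n+[m/n]*n (toℕ i′) blocks ⟨
    toℕ i′                                    ∎)
    where
    open ≡-Reasoning
    remainders : toℕ i % blocks ≡ toℕ i′ % blocks
    remainders = trans (sym (Fin.toℕ-fromℕ< (m%n<n (toℕ i) blocks)))
      (trans (cong toℕ same-block) (Fin.toℕ-fromℕ< (m%n<n (toℕ i′) blocks)))
    quotient< : (k : Fin d) → toℕ k / blocks < 2 ^ width d
    quotient< k = m<n*o⇒m/o<n (<-≤-trans (Fin.toℕ<n k)
      (≤-trans (width-holds d≤) (≤-reflexive (*-comm blocks (2 ^ width d)))))
    just-injective : ∀ {x y : Bool} → just x ≡ just y → x ≡ y
    just-injective refl = refl
    digits : ∀ l → l < width d → digit l (toℕ i / blocks) ≡ digit l (toℕ i′ / blocks)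
    digits l l<w = subst (λ l → digit l (toℕ i / blocks) ≡ digit l (toℕ i′ / blocks)) l̂≡l (just-injective
      (trans (sym (address-width i l̂ l̂<w)) (trans (same-address l̂) (address-width i′ l̂ l̂<w))))
      where
      l<b : l < b
      l<b = <-≤-trans l<w (descend-≤ (λ k → d ≤? blocks * 2 ^ k) b)
      l̂ : Fin b
      l̂ = fromℕ< l<b
      l̂≡l : toℕ l̂ ≡ l
      l̂≡l = Fin.toℕ-fromℕ< l<b
      l̂<w : toℕ l̂ < width d
      l̂<w = subst (_< width d) (sym l̂≡l) l<w
    quotients : toℕ i / blocks ≡ toℕ i′ / blocks
    quotients = digits-injective (width d) _ _ (quotient< i) (quotient< i′) digits

  -- The source of all exclusion: no outcome of the coins selects both ports. It makes queries
  -- unambiguous and cylinders at one apex conflicting.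
  address-conflict : ∀ {d} → d ≤ 2 ^ b → (i i′ : Fin d) → block i ≡ block i′ → i ≢ i′ →
    ∃ λ l → ∃₂ λ x x′ → address i l ≡ just x × address i′ l ≡ just x′ × x ≢ x′
  address-conflict {d} d≤ i i′ same-block i≢i′
    with l , differ ← Fin.¬∀⟶∃¬ b (λ l → address i l ≡ address i′ l) (λ l → Maybe.≡-dec Bool._≟_ (address i l) (address i′ l))
                        (i≢i′ ∘ address-injective d≤ i i′ same-block)
    with toℕ l <? width d
  ... | yes l<w = l , _ , _ , address-width i l l<w , address-width i′ l l<w ,
        λ eq → differ (trans (address-width i l l<w) (trans (cong just eq) (sym (address-width i′ l l<w))))
  ... | no  l≮w = ⊥-elim (differ (trans (beyond i) (sym (beyond i′))))
    where
    beyond : (k : Fin d) → address k l ≡ nothing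
    beyond k with toℕ l <ᵇ width d in eq
    ... | false = refl
    ... | true  = contradiction (<ᵇ⇒< (toℕ l) (width d) (subst T (sym eq) _)) l≮w

  -- Ensures that the arbitrary witness returned by `queried?` is the port whose selection is being
  -- tracked.
  selected-unique : ∀ {d} → d ≤ 2 ^ b → ∀ bits j j′ (i i′ : Fin d) → toℕ (slot j i) ≡ toℕ (slot j′ i′) →
                    Selected bits j i → Selected bits j′ i′ → i ≡ i′
  selected-unique d≤ bits j j′ i i′ same sel sel′ with i Fin.≟ i′
  ... | yes i≡i′ = i≡i′
  ... | no  i≢i′ with same-slot ← Fin.toℕ-injective same
    with l , x , x′ , eq , eq′ , x≢x′ ← address-conflict d≤ i i′ (proj₂ (Fin.combine-injective j (block i) j′ (block i′) same-slot)) i≢i′ =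
    contradiction (trans (fits-just (subst (λ m → Fits m (lookup bits (combine (slot j i) l))) eq (sel l)))
      (sym (fits-just (subst₂ (λ m s → Fits m (lookup bits (combine s l))) eq′ (sym same-slot) (sel′ l))))) x≢x′

  -- Executions on a network

  module On (N : Network b) where

    open Network N
    open Execution protocol N

    neighbour-injective : ∀ v → Injective _≡_ _≡_ (neighbour v)
    neighbour-injective v {i} {i′} eq =
      trans (sym (Inverse.strictlyInverseʳ (port v) i)) (trans (cong (Inverse.from (port v)) pairs≡) (Inverse.strictlyInverseʳ (port v) i′))
      where
      ,-cong : ∀ {u u′} {p : T (edge graph v u)} {p′ : T (edge graph v u′)} → u ≡ u′ → (u , p) ≡ (u′ , p′)
      ,-cong {u} refl = cong (u ,_) (Bool.T-irrelevant _ _)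
      pairs≡ : Inverse.to (port v) i ≡ Inverse.to (port v) i′
      pairs≡ = ,-cong eq

    neighbour-edge : ∀ v i → T (edge graph v (neighbour v i))
    neighbour-edge v i = proj₂ (Inverse.to (port v) i)

    port-to : ∀ {v u} → T (edge graph v u) → ∃ λ i → neighbour v i ≡ u
    port-to {v} {u} vu = Inverse.from (port v) (u , vu) , cong proj₁ (Inverse.strictlyInverseˡ (port v) (u , vu))

    neighbour-back : ∀ v i → neighbour (neighbour v i) (back v i) ≡ v
    neighbour-back v i with Inverse.to (port v) i
    ... | u , vu = cong proj₁ (Inverse.strictlyInverseˡ (port u) _)

    degree≤ : ∀ v → deg v ≤ ∑ (λ w → ⟦ edge graph v w ⟧)
    degree≤ v = injection-count (neighbour v) (neighbour-injective v) (edge graph v) (neighbour-edge v)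

    degree≤2^b : ∀ v → deg v ≤ 2 ^ b
    degree≤2^b v = ≤-trans (Fin.injective⇒≤ (neighbour-injective v)) (vectors-count ident unique)

    module _ (ω : Coins n coinCount) where

      step-running : ∀ σ v → decide (σ v) ≡ nothing →
        step σ v ≡ Protocol.receive protocol (σ v) (λ i → sent σ (neighbour v i) (back v i))
      step-running σ v eq rewrite eq = refl

      sent-running : ∀ σ v i → decide (σ v) ≡ nothing → sent σ v i ≡ Protocol.send protocol (σ v) i
      sent-running σ v i eq rewrite eq = refl

      -- The port certifies that `v` is not isolated. All such nodes keep the same clock, hence none
      -- falls silent before the last round; for a neighbour the certificate is the port leading
      -- back.
      clock-run : ∀ t v → Fin (deg v) → t ≤ rounds → clock (run ω t v) ≡ t
      clock-run zero    v _ _  = refl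
      clock-run (suc t) v p t< = trans (cong clock (step-running (run ω t) v (decide-running (run ω t v) p
          (subst (_< rounds) (sym ih) t<)))) (cong suc ih)
        where
        ih : clock (run ω t v) ≡ t
        ih = clock-run t v p (<⇒≤ t<)

      running : ∀ t v → Fin (deg v) → t < rounds → decide (run ω t v) ≡ nothing
      running t v p t< = decide-running (run ω t v) p (subst (_< rounds) (sym (clock-run t v p (<⇒≤ t<))) t<)

      run-suc : ∀ t v → Fin (deg v) → t < rounds →
        run ω (suc t) v ≡ Protocol.receive protocol (run ω t v) (λ i → sent (run ω t) (neighbour v i) (back v i))
      run-suc t v p t< = step-running (run ω t) v (running t v p t<)

      bits-run : ∀ t v → bits (run ω t v) ≡ lookup ω v
      bits-run zero    v = refl
      bits-run (suc t) v with decide (run ω t v)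
      ... | just _  = bits-run t v
      ... | nothing = bits-run t v

      me-run : ∀ t v → me (run ω t v) ≡ ident v
      me-run zero    v = refl
      me-run (suc t) v with decide (run ω t v)
      ... | just _  = me-run t v
      ... | nothing = me-run t v

      log-run : ∀ t v → Fin (deg v) → t ≤ rounds → ∀ r → r < t →
        log (run ω t v) r ≡ λ i → sent (run ω r) (neighbour v i) (back v i)
      log-run (suc t) v p t< r (s≤s r≤t) rewrite run-suc t v p t< | clock-run t v p (<⇒≤ t<)
        with r ≡ᵇ t in eq
      ... | true  rewrite ≡ᵇ⇒≡ r t (subst T (sym eq) _) = refl
      ... | false = log-run t v p (<⇒≤ t<) r (≤∧≢⇒< r≤t λ r≡t → subst T eq (≡⇒≡ᵇ r t r≡t))

      heard : ∀ t v i r → t ≤ rounds → r < t →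
        log (run ω t v) r i ≡ answer r (run ω r (neighbour v i)) (back v i) ∷ toList (query r (run ω r (neighbour v i)))
      heard t v i r t≤ r<t = begin
        log (run ω t v) r i
          ≡⟨ cong (λ f → f i) (log-run t v i t≤ r r<t) ⟩
        sent (run ω r) (neighbour v i) (back v i)
          ≡⟨ sent-running (run ω r) (neighbour v i) (back v i) (running r (neighbour v i) (back v i) (<-≤-trans r<t t≤)) ⟩
        Protocol.send protocol (run ω r (neighbour v i)) (back v i)
          ≡⟨ cong (λ c → answer c (run ω r (neighbour v i)) (back v i) ∷ toList (query c (run ω r (neighbour v i))))
               (clock-run r (neighbour v i) (back v i) (<⇒≤ (<-≤-trans r<t t≤))) ⟩
        answer r (run ω r (neighbour v i)) (back v i) ∷ toList (query r (run ω r (neighbour v i))) ∎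
        where open ≡-Reasoning

      heard-query : ∀ t v i r → t ≤ rounds → r < t → body (log (run ω t v) r i) ≡ query r (run ω r (neighbour v i))
      heard-query t v i r t≤ r<t = trans (cong body (heard t v i r t≤ r<t)) (decode-toList _)

      ident-run : ∀ t v i → t ≤ rounds → 0 < t → ident-of (run ω t v) i ≡ ident (neighbour v i)
      ident-run t v i t≤ 0<t = trans (heard-query t v i 0 t≤ 0<t) (me-run 0 (neighbour v i))

      query-run : ∀ v j y → suc (toℕ (slot j y)) ≤ rounds → Selected (lookup ω v) j y →
        query (suc (toℕ (slot j y))) (run ω (suc (toℕ (slot j y))) v) ≡ ident (neighbour v y)
      query-run v j y r< sel with queried? (run ω (suc (toℕ (slot j y))) v) (toℕ (slot j y))
      ... | no ¬q = contradiction
        (y , j , refl , subst (λ ω → Selected ω j y) (sym (bits-run (suc (toℕ (slot j y))) v)) sel) ¬q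
      ... | yes (i , j′ , same , sel′) = trans (ident-run (suc (toℕ (slot j y))) v i r< z<s)
        (cong (ident ∘ neighbour v) (selected-unique (degree≤2^b v) (lookup ω v) j′ j i y same
          (subst (λ ω → Selected ω j′ i) (bits-run (suc (toℕ (slot j y))) v) sel′) sel))

      module _ (v : Fin n) (j : Fin e) (y : Fin (deg v)) (sel : Selected (lookup ω v) j y) (i : Fin (deg v)) where

        private
          r : ℕ
          r = toℕ (slot j y)
          r< : 2 + r < rounds
          r< = s≤s (s≤s (Fin.toℕ<n (slot j y)))
          w : Fin n
          w = neighbour v i
          st : State (deg w)
          st = run ω (2 + r) w

          asked : body (log st (suc r) (back v i)) ≡ ident (neighbour v y)
          asked = trans (heard-query (2 + r) w (back v i) (suc r) (<⇒≤ r<) ≤-refl)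
            (trans (cong (λ u → query (suc r) (run ω (suc r) u)) (neighbour-back v i))
              (query-run v j y (≤-trans (n≤1+n _) (<⇒≤ r<)) sel))

          reply : flag (log (run ω rounds v) (2 + r) i) ≡ does (adjacent? st (ident (neighbour v y)))
          reply = trans (cong flag (heard rounds v i (2 + r) ≤-refl r<)) (cong (λ x → does (adjacent? st x)) asked)

          known : ∀ k → ident-of st k ≡ ident (neighbour w k)
          known k = ident-run (2 + r) w k (<⇒≤ r<) z<s

        reply⇒edge : T (flag (log (run ω rounds v) (2 + r) i)) → T (edge graph (neighbour v i) (neighbour v y))
        reply⇒edge yes! with adjacent? st (ident (neighbour v y)) | subst T reply yes!
        ... | yes (k , eq) | _ = subst (λ u → T (edge graph w u)) (unique (trans (sym (known k)) eq)) (neighbour-edge w k)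

        edge⇒reply : T (edge graph (neighbour v i) (neighbour v y)) → T (flag (log (run ω rounds v) (2 + r) i))
        edge⇒reply wy with k , eq ← port-to wy =
          subst T (sym reply) (T-does (adjacent? st _) (k , trans (known k) (cong ident eq)))

      -- Answers are truthful, as they compare the query with identifiers learnt in round 0, which
      -- are unique. Of two different entries of `z` at least one has an index `suc j`, so the
      -- answers in role `j` certify the edge between them; entry `zero` is never asked about.
      reject⇒clique : ∀ v → Reject (run ω rounds v) → ∃ λ (φ : Fin (2 + e) → Fin n) → Clique graph φ
      reject⇒clique v (z , sel , adj) = φ , clique
        where
        φ : Fin (2 + e) → Fin n
        φ zero    = v
        φ (suc i) = neighbour v (lookup z i)
        sel′ : ∀ j → Selected (lookup ω v) j (lookup z (suc j))
        sel′ j = subst (λ ω → Selected ω j (lookup z (suc j))) (bits-run rounds v) (sel j)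
        edge-to : ∀ i j → i ≢ suc j → T (edge graph (φ (suc i)) (φ (suc (suc j))))
        edge-to i j i≢j = reply⇒edge v j (lookup z (suc j)) (sel′ j) (lookup z i) (adj j i i≢j)
        flip : ∀ {u u′} → T (edge graph u u′) → T (edge graph u′ u)
        flip {u} {u′} = subst T (symm graph u u′)
        clique : Clique graph φ
        clique zero          zero          i≢j = contradiction refl i≢j
        clique zero          (suc i)       _   = neighbour-edge v (lookup z i)
        clique (suc i)       zero          _   = flip (neighbour-edge v (lookup z i))
        clique (suc i)       (suc (suc j)) i≢j = edge-to i j (i≢j ∘ cong suc)
        clique (suc (suc i)) (suc zero)    _   = flip (edge-to zero i λ ())
        clique (suc zero)    (suc zero)    i≢j = contradiction refl i≢j

      clique⇒reject : ∀ v (z : Vec (Fin (deg v)) (suc e)) →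
        (∀ j → Selected (lookup ω v) j (lookup z (suc j))) →
        Clique graph (λ i → neighbour v (lookup z i)) → Reject (run ω rounds v)
      clique⇒reject v z sel cl = z ,
        (λ j → subst (λ ω → Selected ω j (lookup z (suc j))) (sym (bits-run rounds v)) (sel j)) ,
        (λ j i i≢j → edge⇒reply v j (lookup z (suc j)) (sel j) (lookup z i) (cl i (suc j) i≢j))

      output-run : ∀ v → Fin (deg v) → output rounds ω v ≡ just (not (does (reject? (run ω rounds v))))
      output-run v p = decide-final (run ω rounds v) p (clock-run rounds v p ≤-refl)

      output-isolated : ∀ t v → ¬ Fin (deg v) → output t ω v ≡ just true
      output-isolated t v ¬p = isolated (run ω t v) ¬p
        where
        isolated : ∀ {d} (st : State d) → ¬ Fin d → decide st ≡ just true
        isolated {zero}  st _  = refl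
        isolated {suc d} st ¬p = contradiction zero ¬p

    port? : ∀ d → Dec (Fin d)
    port? zero    = no λ ()
    port? (suc d) = yes zero

    halts : HaltsWithin rounds
    halts ω v with port? (deg v)
    ... | yes p = subst Is-just (sym (output-run ω v p)) (just _)
    ... | no ¬p = subst Is-just (sym (output-isolated ω rounds v ¬p)) (just _)

    free⇒accept : (K (2 + e) -Free) graph → ∀ ω → AllAccept rounds ω
    free⇒accept free ω v with port? (deg v)
    ... | no ¬p = output-isolated ω rounds v ¬p
    ... | yes p = trans (output-run ω v p) (cong (just ∘ not) (dec-false (reject? (run ω rounds v))
      λ rej → free (clique⇒⊑ graph (proj₂ (reject⇒clique ω v rej)))))

    reject⇒someRejects : ∀ ω v → Fin (deg v) → Reject (run ω rounds v) → SomeRejects rounds ω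
    reject⇒someRejects ω v p rej =
      v , trans (output-run ω v p) (cong (just ∘ not) (dec-true (reject? (run ω rounds v)) rej))

    isolated-halts : (∀ v → ¬ Fin (deg v)) → HaltsWithin 0
    isolated-halts iso ω v = subst Is-just (sym (output-isolated ω 0 v (iso v))) (just _)

    bandwidth : Bandwidth≤ (suc b)
    bandwidth ω t v i with decide (run ω t v)
    ... | just _  = z≤n
    ... | nothing = s≤s (≤-reflexive (Vec.length-toList (query (clock (run ω t v)) (run ω t v))))

-- Probability of detection

module Detection (e τ b : ℕ) (N : Network b) where

  open Tester e τ b
  open On N
  open Network N
  open Execution protocol N

  spell-in : ∀ {d} → (Fin e → Fin d) → Fin b → Fin e × Fin blocks → Maybe Bool
  spell-in y l (j , q) = if does (block (y j) Fin.≟ q) then address (y j) l else nothing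

  -- The coins that make a node with d ports select port y j in role j, for all j.
  spell : ∀ {d} → (Fin e → Fin d) → Fin slots × Fin b → Maybe Bool
  spell y (r , l) = spell-in y l (remQuot {e} blocks r)

  aim : ∀ u → (Fin e → Fin (deg u)) → Cylinder n coinCount
  aim u y v p = if does (u Fin.≟ v) then spell y (remQuot {slots} b p) else nothing

  aim-at : ∀ u y j q l → aim u y u (combine {slots} {b} (combine {e} {blocks} j q) l) ≡
           (if does (block (y j) Fin.≟ q) then address (y j) l else nothing)
  aim-at u y j q l = trans
    (cong (λ t → if t then spell y (remQuot {slots} b (combine {slots} {b} (combine {e} {blocks} j q) l)) else nothing)
      (dec-true (u Fin.≟ u) refl))
    (trans (cong (spell y) (Fin.remQuot-combine {slots} {b} (combine {e} {blocks} j q) l))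
      (cong (spell-in y l) (Fin.remQuot-combine {e} {blocks} j q)))

  aim-elsewhere : ∀ u y v p → u ≢ v → aim u y v p ≡ nothing
  aim-elsewhere u y v p u≢v rewrite dec-false (u Fin.≟ v) u≢v = refl

  aim-selects : ∀ u y ω → 0 < indicator (aim u y) ω → ∀ j → Selected (lookup ω u) j (y j)
  aim-selects u y ω 0<ind j l = subst (λ m → Fits m (lookup (lookup ω u) (combine (slot j (y j)) l)))
    (trans (aim-at u y j (block (y j)) l)
      (cong (λ x → if x then address (y j) l else nothing) (dec-true (block (y j) Fin.≟ block (y j)) refl)))
    (indicator⇒fits (aim u y) ω 0<ind u (combine (slot j (y j)) l))

  -- Different apexes use the private coins of different nodes.
  aim-independent : ∀ {u u′} y y′ → u ≢ u′ → Independent (aim u y) (aim u′ y′)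
  aim-independent {u} {u′} y y′ u≢u′ v p with u Fin.≟ v
  ... | no u≢v   = inj₁ refl
  ... | yes refl = inj₂ (aim-elsewhere u′ y′ u p (u≢u′ ∘ sym))

  -- If some role aims at the same block twice, the two addresses there conflict; otherwise every
  -- role uses different slots, hence different coins.
  aim-correlation : ∀ u (y y′ : Fin e → Fin (deg u)) → (∀ j → y j ≢ y′ j) →
    Independent (aim u y) (aim u y′) ⊎ Conflicting (aim u y) (aim u y′)
  aim-correlation u y y′ y≢y′ with Fin.any? (λ j → block (y j) Fin.≟ block (y′ j))
  ... | yes (j , same) with l , x , x′ , eq , eq′ , x≢x′ ← address-conflict (degree≤2^b u) (y j) (y′ j) same (y≢y′ j) =
    inj₂ (u , combine (slot j (y j)) l , x , x′ ,
      at y refl eq , at y′ (sym same) eq′ , x≢x′)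
    where
    at : ∀ z {x} → block (z j) ≡ block (y j) → address (z j) l ≡ just x →
         aim u z u (combine (slot j (y j)) l) ≡ just x
    at z same eq = trans (aim-at u z j (block (y j)) l)
      (trans (cong (λ t → if t then address (z j) l else nothing) (dec-true (block (z j) Fin.≟ block (y j)) same)) eq)
  ... | no ¬same = inj₁ free
    where
    spell-free : ∀ l jq → spell-in y l jq ≡ nothing ⊎ spell-in y′ l jq ≡ nothing
    spell-free l (j , q) with block (y j) Fin.≟ q
    ... | no _  = inj₁ refl
    ... | yes y∈q = inj₂ (cong (λ t → if t then address (y′ j) l else nothing)
      (dec-false (block (y′ j) Fin.≟ q) λ y′∈q → ¬same (j , trans y∈q (sym y′∈q))))
    free : Independent (aim u y) (aim u y′)
    free v p with u Fin.≟ v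
    ... | no _  = inj₁ refl
    ... | yes _ = spell-free (proj₂ (remQuot {slots} b p)) (remQuot {e} blocks (proj₁ (remQuot {slots} b p)))

  address-cost : ∀ {d} (i : Fin d) → ∏ (λ l → cost (address i l)) ≤ 2 ^ width d
  address-cost {d} i = ≤-trans (∏-mono bound) (prefix b (width d))
    where
    bound : ∀ l → cost (address i l) ≤ (if toℕ l <ᵇ width d then 2 else 1)
    bound l with toℕ l <ᵇ width d
    ... | true  = ≤-refl
    ... | false = ≤-refl
    prefix : ∀ b w → ∏ {b} (λ l → if toℕ l <ᵇ w then 2 else 1) ≤ 2 ^ w
    prefix zero    w       = ≤-trans (≤-reflexive (∏-empty _)) (m^n>0 2 w)
    prefix (suc b) zero    = ≤-reflexive (∏-ones {suc b} λ _ → refl)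
    prefix (suc b) (suc w) = ≤-trans (≤-reflexive (∏-suc {b} _)) (*-monoʳ-≤ 2 (prefix b w))

  -- Among the coins of `u`, each role prescribes only those of the one slot containing its port,
  -- and at most `width (deg u)` of them.
  aim-cost : ∀ u y → ∏∏ (λ v p → cost (aim u y v p)) ≤ (2 ^ width (deg u)) ^ e
  aim-cost u y = begin
    ∏∏ (λ v p → cost (aim u y v p))
      ≡⟨ ∏-single _ u (λ v v≢u → ∏-ones λ p → cong cost (aim-elsewhere u y v p (v≢u ∘ sym))) ⟩
    ∏ (λ p → cost (aim u y u p))
      ≡⟨ ∏-combine slots {b} (λ p → cost (aim u y u p)) ⟩
    ∏ (λ r → ∏ λ l → cost (aim u y u (combine {slots} {b} r l)))
      ≡⟨ ∏-combine e {blocks} (λ r → ∏ λ l → cost (aim u y u (combine {slots} {b} r l))) ⟩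
    ∏ (λ j → ∏ λ q → ∏ λ l → cost (aim u y u (combine {slots} {b} (combine {e} {blocks} j q) l)))
      ≡⟨ ∏-cong (λ j → ∏-cong λ q → ∏-cong λ l → cong cost (aim-at u y j q l)) ⟩
    ∏ (λ j → ∏ λ q → ∏ λ l → cost (if does (block (y j) Fin.≟ q) then address (y j) l else nothing))
      ≤⟨ ∏-upper role ⟩
    (2 ^ width (deg u)) ^ e ∎
    where
    open ≤-Reasoning
    in-block : Fin e → Fin blocks → ℕ
    in-block j q = ∏ λ l → cost (if does (block (y j) Fin.≟ q) then address (y j) l else nothing)
    role : ∀ j → ∏ (in-block j) ≤ 2 ^ width (deg u)
    role j = begin
      ∏ (in-block j)
        ≡⟨ ∏-single (in-block j) (block (y j)) (λ q q≢ → ∏-ones λ l →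
             cong (λ t → cost (if t then address (y j) l else nothing)) (dec-false (block (y j) Fin.≟ q) (q≢ ∘ sym))) ⟩
      in-block j (block (y j))
        ≡⟨ ∏-cong (λ l → cong (λ t → cost (if t then address (y j) l else nothing)) (dec-true (block (y j) Fin.≟ block (y j)) refl)) ⟩
      ∏ (λ l → cost (address (y j) l))
        ≤⟨ address-cost (y j) ⟩
      2 ^ width (deg u) ∎

  module _ {size} (Φ : Fin size → Fin (2 + e) → Fin n)
           (cliques : ∀ a → Clique graph (Φ a))
           (disjoint : ∀ a b → a ≢ b → EdgeDisjoint (Φ a) (Φ b)) where

    private
      apex : Fin size → Fin n
      apex a = Φ a zero

      apex-port : ∀ a i → ∃ λ k → neighbour (apex a) k ≡ Φ a (suc i)
      apex-port a i = port-to (cliques a zero (suc i) λ ())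

      ports : ∀ a → Vec (Fin (deg (apex a))) (suc e)
      ports a = tabulate (proj₁ ∘ apex-port a)

      ports-neighbour : ∀ a i → neighbour (apex a) (lookup (ports a) i) ≡ Φ a (suc i)
      ports-neighbour a i = trans (cong (neighbour (apex a)) (Vec.lookup∘tabulate (proj₁ ∘ apex-port a) i)) (proj₂ (apex-port a i))

      arms : ∀ a → Fin e → Fin (deg (apex a))
      arms a j = lookup (ports a) (suc j)

      cylinder : Fin size → Cylinder n coinCount
      cylinder a = aim (apex a) (arms a)

      selected⇒rejects : ∀ a ω → (∀ j → Selected (lookup ω (apex a)) j (arms a j)) → SomeRejects rounds ω
      selected⇒rejects a ω sel = reject⇒someRejects ω (apex a) (lookup (ports a) zero)
        (clique⇒reject ω (apex a) (ports a) sel λ i i′ i≢i′ →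
          subst₂ (λ u v → T (edge graph u v)) (sym (ports-neighbour a i)) (sym (ports-neighbour a i′))
            (cliques a (suc i) (suc i′) (i≢i′ ∘ Fin.suc-injective)))

      correlated : ∀ a b → a ≢ b →
        Independent (cylinder a) (cylinder b) ⊎ Conflicting (cylinder a) (cylinder b)
      correlated a b a≢b with apex a Fin.≟ apex b
      ... | no  u≢u′ = inj₁ (aim-independent (arms a) (arms b) u≢u′)
      ... | yes u≡u′ = same-apex (apex b) (arms b) u≡u′ λ j → ports-neighbour b (suc j)
        where
        -- Two edge-disjoint cliques that share their apex have no other vertex in common.
        same-apex : ∀ u (y : Fin e → Fin (deg u)) → apex a ≡ u → (∀ j → neighbour u (y j) ≡ Φ b (suc (suc j))) →
          Independent (cylinder a) (aim u y) ⊎ Conflicting (cylinder a) (aim u y)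
        same-apex u y refl nbr = aim-correlation (apex a) (arms a) y λ j eq →
          contradiction (clique-injective graph (cliques a)
              (disjoint a b a≢b zero (suc (suc j)) zero (suc (suc j)) u≡u′
                (trans (sym (ports-neighbour a (suc j))) (trans (cong (neighbour (apex a)) eq) (nbr j)))))
            λ ()

      volume-large : ∀ a → 2 ^ (n * coinCount) ≤ volume (cylinder a) * (2 ^ width (deg (apex a))) ^ e
      volume-large a = ≤-trans (≤-reflexive (sym (volume*cost (cylinder a))))
        (*-monoʳ-≤ (volume (cylinder a)) (aim-cost (apex a) (arms a)))

    -- At width 0 the addresses prescribe nothing, so every port is selected in every role.
    detected-surely : ∀ a → width (deg (Φ a zero)) ≡ 0 → ℤ.+ 2 ℚ./ 3 ℚ.≤ Pr (someRejects? rounds)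
    detected-surely a width≡0 = Pr-certain≥2/3 (someRejects? rounds) λ ω →
      selected⇒rejects a ω λ j l → subst (λ w → Fits (if toℕ l <ᵇ w then just (digit (toℕ l) (toℕ (arms a j) / blocks)) else nothing) (lookup (lookup ω (apex a)) (combine (slot j (arms a j)) l)))
        (sym width≡0) z<s

    -- Each of the `size` events has probability at least `2 / size`, so at least 2 of them are
    -- expected.
    detected-likely : 0 < size → (∀ a → 2 * (2 ^ width (deg (Φ a zero))) ^ e ≤ size) →
                      ℤ.+ 2 ℚ./ 3 ℚ.≤ Pr (someRejects? rounds)
    detected-likely 0<size enough = second-moment-method cylinder
      (λ a b a≢b → nonpositively-correlated (cylinder a) (cylinder b) (correlated a b a≢b))
      (someRejects? rounds)
      (λ a ω 0<ind → selected⇒rejects a ω (aim-selects (apex a) (arms a) ω 0<ind))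
      (*-cancelˡ-≤ size {{>-nonZero 0<size}} (begin
        size * (2 * M)                              ≤⟨ ∑-lower share ⟩
        ∑ (λ a → volume (cylinder a) * size)        ≡⟨ *-distribʳ-∑ size (λ a → volume (cylinder a)) ⟨
        ∑ (λ a → volume (cylinder a)) * size        ≡⟨ *-comm _ size ⟩
        size * ∑ (λ a → volume (cylinder a))        ∎))
      where
      open ≤-Reasoning
      M : ℕ
      M = 2 ^ (n * coinCount)
      share : ∀ a → 2 * M ≤ volume (cylinder a) * size
      share a = begin
        2 * M                                                            ≤⟨ *-monoʳ-≤ 2 (volume-large a) ⟩
        2 * (volume (cylinder a) * (2 ^ width (deg (apex a))) ^ e)       ≡⟨ swap (volume (cylinder a)) _ ⟩
        volume (cylinder a) * (2 * (2 ^ width (deg (apex a))) ^ e)       ≤⟨ *-monoʳ-≤ (volume (cylinder a)) (enough a) ⟩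
        volume (cylinder a) * size                                       ∎
        where
        swap : ∀ x y → 2 * (x * y) ≡ x * (2 * y)
        swap = solve-∀

-- Clearing denominators

fromℕ≃ : ∀ k → ℚ.toℚᵘ (fromℕ k) ℚᵘ.≃ ℚᵘ.mkℚᵘ (ℤ.+ k) 0
fromℕ≃ k = ℚ.toℚᵘ-fromℚᵘ (ℚᵘ.mkℚᵘ (ℤ.+ k) 0)

fromℕ-* : ∀ x y → fromℕ (x * y) ≡ fromℕ x ℚ.* fromℕ y
fromℕ-* x y = ℚ.toℚᵘ-injective (ℚᵘ.≃-trans (fromℕ≃ (x * y)) (ℚᵘ.≃-sym
  (ℚᵘ.≃-trans (ℚ.toℚᵘ-homo-* (fromℕ x) (fromℕ y))
    (ℚᵘ.≃-trans (ℚᵘ.*-cong (fromℕ≃ x) (fromℕ≃ y)) (ℚᵘ.*≡* (cong (ℤ._* ℤ.+ 1) (sym (ℤ.pos-* x y))))))))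

fromℕ-mono-≤ : ∀ {x y} → x ≤ y → fromℕ x ℚ.≤ fromℕ y
fromℕ-mono-≤ {x} {y} x≤y = /-mono-≤ x 1 y 1 (*-monoˡ-≤ 1 x≤y)

fromℕ-cancel-≤ : ∀ {x y} → fromℕ x ℚ.≤ fromℕ y → x ≤ y
fromℕ-cancel-≤ {x} {y} le = subst₂ _≤_ (*-identityʳ x) (*-identityʳ y) (ℤ.drop‿+≤+
  (subst₂ ℤ._≤_ (sym (ℤ.pos-* x 1)) (sym (ℤ.pos-* y 1))
    (ℚᵘ.drop-*≤* (ℚᵘ.≤-respˡ-≃ (fromℕ≃ x) (ℚᵘ.≤-respʳ-≃ (fromℕ≃ y) (ℚ.toℚᵘ-mono-≤ le))))))

num den : ℚ → ℕ
num ε = ℤ.∣ ℚ.↥ ε ∣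
den ε = ℚ.↧ₙ ε

module _ (ε : ℚ) (0<ε : 0ℚ ℚ.< ε) where

  private
    ε≃ : ∀ ε → 0ℚ ℚ.< ε → ℚ.↥ ε ≡ ℤ.+ num ε × 0 < num ε
    ε≃ (ℚ.mkℚ (ℤ.+ zero)    _ _) (ℚ.*<* (ℤ.+<+ ()))
    ε≃ (ℚ.mkℚ (ℤ.+ suc p)   _ _) _ = refl , z<s
    ε≃ (ℚ.mkℚ (ℤ.-[1+ p ])  _ _) (ℚ.*<* ())

  num>0 : 0 < num ε
  num>0 = proj₂ (ε≃ ε 0<ε)

  num≤den : ε ℚ.≤ 1ℚ → num ε ≤ den ε
  num≤den (ℚ.*≤* le) = ℤ.drop‿+≤+ (subst₂ ℤ._≤_ (trans (ℤ.*-identityʳ _) (proj₁ (ε≃ ε 0<ε))) (ℤ.*-identityˡ _) le)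

  ε*den : ε ℚ.* fromℕ (den ε) ≡ fromℕ (num ε)
  ε*den = ℚ.toℚᵘ-injective (ℚᵘ.≃-trans (ℚ.toℚᵘ-homo-* ε (fromℕ (den ε)))
    (ℚᵘ.≃-trans (ℚᵘ.*-cong (ℚᵘ.≃-refl {ℚ.toℚᵘ ε}) (fromℕ≃ (den ε)))
      (ℚᵘ.≃-trans (cleared ε 0<ε) (ℚᵘ.≃-sym (fromℕ≃ (num ε))))))
    where
    cleared : ∀ ε → 0ℚ ℚ.< ε → ℚ.toℚᵘ ε ℚᵘ.* ℚᵘ.mkℚᵘ (ℤ.+ den ε) 0 ℚᵘ.≃ ℚᵘ.mkℚᵘ (ℤ.+ num ε) 0
    cleared ε@(ℚ.mkℚ _ _ _) 0<ε = ℚᵘ.*≡* (trans (ℤ.*-identityʳ _)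
      (cong₂ ℤ._*_ (proj₁ (ε≃ ε 0<ε)) (cong ℤ.+_ (sym (*-identityʳ (den ε))))))

  ε^*den^ : ∀ s → (ε ^ℚ s) ℚ.* fromℕ (den ε ^ s) ≡ fromℕ (num ε ^ s)
  ε^*den^ zero    = ℚ.*-identityˡ (fromℕ 1)
  ε^*den^ (suc s) = begin
    (ε ℚ.* (ε ^ℚ s)) ℚ.* fromℕ (den ε * den ε ^ s)
      ≡⟨ cong ((ε ℚ.* (ε ^ℚ s)) ℚ.*_) (fromℕ-* (den ε) (den ε ^ s)) ⟩
    (ε ℚ.* (ε ^ℚ s)) ℚ.* (fromℕ (den ε) ℚ.* fromℕ (den ε ^ s))
      ≡⟨ interchange ε (ε ^ℚ s) (fromℕ (den ε)) (fromℕ (den ε ^ s)) ⟩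
    (ε ℚ.* fromℕ (den ε)) ℚ.* ((ε ^ℚ s) ℚ.* fromℕ (den ε ^ s))
      ≡⟨ cong₂ ℚ._*_ ε*den (ε^*den^ s) ⟩
    fromℕ (num ε) ℚ.* fromℕ (num ε ^ s)
      ≡⟨ fromℕ-* (num ε) (num ε ^ s) ⟨
    fromℕ (num ε * num ε ^ s) ∎
    where
    open ≡-Reasoning
    open CommutativeSemigroup (CommutativeMonoid.commutativeSemigroup ℚ.*-1-commutativeMonoid) using (interchange)

  private
    fromℕ-pos : ∀ k → 0 < k → ℚ.Positive (fromℕ k)
    fromℕ-pos (suc k) _ = ℚ.normalize-pos (suc k) 1

  power-≤ : ∀ s x y → x * num ε ^ s ≤ y * den ε ^ s → fromℕ x ℚ.* (ε ^ℚ s) ℚ.≤ fromℕ y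
  power-≤ s x y le = ℚ.*-cancelʳ-≤-pos (fromℕ (den ε ^ s)) {{fromℕ-pos _ (m^n>0 (den ε) s)}}
    (subst₂ ℚ._≤_
      (trans (fromℕ-* x _) (trans (cong (fromℕ x ℚ.*_) (sym (ε^*den^ s))) (sym (ℚ.*-assoc (fromℕ x) _ _))))
      (fromℕ-* y _) (fromℕ-mono-≤ le))

  ε*≤⇒ : ∀ x y → ε ℚ.* fromℕ x ℚ.≤ fromℕ y → num ε * x ≤ den ε * y
  ε*≤⇒ x y le = fromℕ-cancel-≤ (subst₂ ℚ._≤_ left right
    (ℚ.*-monoˡ-≤-nonNeg (fromℕ (den ε)) {{ℚ.pos⇒nonNeg (fromℕ (den ε)) {{fromℕ-pos (den ε) z<s}}}} le))
    where
    open ≡-Reasoning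
    left : fromℕ (den ε) ℚ.* (ε ℚ.* fromℕ x) ≡ fromℕ (num ε * x)
    left = begin
      fromℕ (den ε) ℚ.* (ε ℚ.* fromℕ x)  ≡⟨ ℚ.*-assoc (fromℕ (den ε)) ε (fromℕ x) ⟨
      fromℕ (den ε) ℚ.* ε ℚ.* fromℕ x    ≡⟨ cong (ℚ._* fromℕ x) (trans (ℚ.*-comm (fromℕ (den ε)) ε) ε*den) ⟩
      fromℕ (num ε) ℚ.* fromℕ x          ≡⟨ fromℕ-* (num ε) x ⟨
      fromℕ (num ε * x)                  ∎
    right : fromℕ (den ε) ℚ.* fromℕ y ≡ fromℕ (den ε * y)
    right = sym (fromℕ-* (den ε) y)

-- Powers, and the choice of the apex

^-distribʳ-* : ∀ n x y → (x * y) ^ n ≡ x ^ n * y ^ n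
^-distribʳ-* zero    x y = refl
^-distribʳ-* (suc n) x y = trans (cong (x * y *_) (^-distribʳ-* n x y)) ([m*n]*[o*p]≡[m*o]*[n*p] x y (x ^ n) (y ^ n))

^-double : ∀ x n → x ^ (2 * n) ≡ (x * x) ^ n
^-double x n = trans (sym (^-*-assoc x 2 n)) (cong (λ y → (x * y) ^ n) (*-identityʳ x))

square-cancel-≤ : ∀ {x y} → x * x ≤ y * y → x ≤ y
square-cancel-≤ {x} {y} xx≤yy with x ≤? y
... | yes x≤y = x≤y
... | no  x≰y = contradiction xx≤yy (<⇒≱ (*-mono-< (≰⇒> x≰y) (≰⇒> x≰y)))

swap₀₁ : ∀ {k} → Fin (2 + k) → Fin (2 + k)
swap₀₁ zero          = suc zero
swap₀₁ (suc zero)    = zero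
swap₀₁ (suc (suc i)) = suc (suc i)

swap₀₁-involutive : ∀ {k} (i : Fin (2 + k)) → swap₀₁ (swap₀₁ i) ≡ i
swap₀₁-involutive zero          = refl
swap₀₁-involutive (suc zero)    = refl
swap₀₁-involutive (suc (suc i)) = refl

-- Comparing two vertices suffices: on a single light edge, the square of the smaller degree is at
-- most the product of the degrees.
arrangement : ∀ {k n} (weight : Fin n → ℕ) (φ : Fin (2 + k) → Fin n) →
  ∃ λ (π : Fin (2 + k) → Fin (2 + k)) → (∀ {i j} → π i ≡ π j → i ≡ j) ×
    weight (φ (π zero)) ≤ weight (φ (π (suc zero)))
arrangement weight φ with ≤-total (weight (φ zero)) (weight (φ (suc zero)))
... | inj₁ ≤ = id , id , ≤
... | inj₂ ≤ = swap₀₁ , (λ {i} {j} eq → trans (sym (swap₀₁-involutive i)) (trans (cong swap₀₁ eq) (swap₀₁-involutive j))) , ≤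

-- Edge-disjoint cliques in a graph far from clique-free

-- Here p / q is ε, so that the first vertex of each clique has degree O(√(m / ε)).
record LightCliques {b} (N : Network b) (s p q : ℕ) : Set where
  open Network N
  field
    size     : ℕ
    member   : Fin size → Fin (2 + s) → Fin n
    cliques  : ∀ a → Clique graph (member a)
    disjoint : ∀ a b → a ≢ b → EdgeDisjoint (member a) (member b)
    light    : ∀ a → p * (deg (member a zero) * deg (member a zero)) ≤ 8 * edgeCount graph * q
    many     : p * edgeCount graph ≤ 2 * ((2 + s) * (2 + s)) * q * size

module _ {b} (N : Network b) (k : ℕ) (ε : ℚ) (0<ε : 0ℚ ℚ.< ε)
         (0<m : 0 < edgeCount (Network.graph N))
         (far : Far ε (K (2 + k) -Free) (Network.graph N)) where

  open Network N

  private
    s m p q : ℕ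
    s = 2 + k
    m = edgeCount graph
    p = num ε
    q = den ε

    heavy? : ∀ u v → Dec (8 * m * q < p * (deg u * deg v))
    heavy? u v = 8 * m * q <? p * (deg u * deg v)

    light : Fin n → Fin n → Bool
    light u v = not (does (heavy? u v))

    light-sym : ∀ u v → light u v ≡ light v u
    light-sym u v = cong (λ x → not (does (8 * m * q <? p * x))) (*-comm (deg u) (deg v))

    lightGraph : Graph n
    lightGraph = restrict graph light light-sym

    packing : Packing s lightGraph
    packing = pack (s≤s (s≤s z≤n)) (arcs lightGraph) lightGraph ≤-refl

    open Packing packing

    heavyCount : ℕ
    heavyCount = ∑∑ λ u v → ⟦ edge graph u v ∧ not (light u v) ⟧

    degrees : ∑ deg ≤ 2 * m
    -- `degree≤` concerns the network alone, so the tester parameters 0 and 0 are arbitrary.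
    degrees = ≤-trans (∑-mono (Tester.On.degree≤ 0 0 b N)) (arcs≤2edges graph)

    -- Each heavy arc has degree product above `8 * m * q / p`, while these products sum over all
    -- ordered pairs to the square of the degree sum, at most `4 * m * m`.
    few-heavy : 2 * (heavyCount * q) ≤ p * m
    few-heavy = *-cancelˡ-≤ (4 * m) {{m*n≢0 4 m {{_}} {{>-nonZero 0<m}}}} (begin
      4 * m * (2 * (heavyCount * q))                       ≡⟨ regroup heavyCount m q ⟩
      heavyCount * (8 * m * q)                             ≡⟨ trans (*-distribʳ-∑ (8 * m * q) _) (∑-cong λ u → *-distribʳ-∑ (8 * m * q) _) ⟩
      ∑∑ (λ u v → ⟦ edge graph u v ∧ not (light u v) ⟧ * (8 * m * q)) ≤⟨ ∑∑-mono heavy-degrees ⟩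
      ∑∑ (λ u v → p * (deg u * deg v))                     ≡⟨ ∑-cong (λ u → sym (*-distribˡ-∑ p (λ v → deg u * deg v))) ⟩
      ∑ (λ u → p * ∑ (λ v → deg u * deg v))                ≡⟨ *-distribˡ-∑ p (λ u → ∑ (λ v → deg u * deg v)) ⟨
      p * ∑∑ (λ u v → deg u * deg v)                       ≡⟨ cong (p *_) (∑-* deg deg) ⟩
      p * (∑ deg * ∑ deg)                                  ≤⟨ *-monoʳ-≤ p (*-mono-≤ degrees degrees) ⟩
      p * (2 * m * (2 * m))                                ≡⟨ square p m ⟩
      4 * m * (p * m)                                      ∎)
      where
      open ≤-Reasoning
      regroup : ∀ h m q → 4 * m * (2 * (h * q)) ≡ h * (8 * m * q)
      regroup = solve-∀
      square : ∀ p m → p * (2 * m * (2 * m)) ≡ 4 * m * (p * m)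
      square = solve-∀
      excess : ∀ x {A B} (h? : Dec (A < B)) → ⟦ x ∧ not (not (does h?)) ⟧ * A ≤ B
      excess false _       = z≤n
      excess true  (yes h) = ≤-trans (≤-reflexive (*-identityˡ _)) (<⇒≤ h)
      excess true  (no _)  = z≤n
      heavy-degrees : ∀ u v → ⟦ edge graph u v ∧ not (light u v) ⟧ * (8 * m * q) ≤ p * (deg u * deg v)
      heavy-degrees u v = excess (edge graph u v) (heavy? u v)

    -- Adding `arcs rest` to both sides replaces the symmetric difference by `arcs graph`, as `rest`
    -- is a subgraph; the lost arcs are heavy or lie in packed cliques.
    edits : editDistance graph rest ≤ size * (s * s) + heavyCount
    edits = +-cancelʳ-≤ (arcs rest) _ _ (begin
      editDistance graph rest + arcs rest
        ≤⟨ +-monoˡ-≤ (arcs rest) (editDistance≤ graph rest) ⟩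
      ∑∑ (λ u v → ⟦ edge graph u v xor edge rest u v ⟧) + arcs rest
        ≡⟨ ∑∑-+ (λ u v → ⟦ edge graph u v xor edge rest u v ⟧) (λ u v → ⟦ edge rest u v ⟧) ⟨
      ∑∑ (λ u v → ⟦ edge graph u v xor edge rest u v ⟧ + ⟦ edge rest u v ⟧)
        ≤⟨ ∑∑-mono (λ u v → removed (restrict⊆ graph light light-sym u v ∘ rest⊆ u v)) ⟩
      arcs graph
        ≤⟨ arcs-restrict graph light light-sym ⟩
      arcs lightGraph + heavyCount
        ≤⟨ +-monoˡ-≤ heavyCount loss ⟩
      arcs rest + size * (s * s) + heavyCount
        ≡⟨ rotate (arcs rest) (size * (s * s)) heavyCount ⟩
      size * (s * s) + heavyCount + arcs rest ∎)
      where
      open ≤-Reasoning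
      removed : ∀ {x y} → (T y → T x) → ⟦ x xor y ⟧ + ⟦ y ⟧ ≤ ⟦ x ⟧
      removed {true}  {true}  _ = ≤-refl
      removed {true}  {false} _ = ≤-refl
      removed {false} {true}  f = ⊥-elim (f _)
      removed {false} {false} _ = ≤-refl
      rotate : ∀ x y z → x + y + z ≡ y + z + x
      rotate = solve-∀

    -- Farness is used twice, so that the heavy arcs, worth at most half of `p * m`, cancel one copy
    -- of it.
    many-cliques : p * m ≤ 2 * (s * s) * q * size
    many-cliques = +-cancelˡ-≤ (p * m) _ _ (begin
      p * m + p * m                                    ≤⟨ +-mono-≤ far′ far′ ⟩
      q * (size * (s * s) + heavyCount) + q * (size * (s * s) + heavyCount) ≡⟨ regroup q size (s * s) heavyCount ⟩
      2 * (heavyCount * q) + 2 * (s * s) * q * size    ≤⟨ +-monoˡ-≤ _ few-heavy ⟩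
      p * m + 2 * (s * s) * q * size                   ∎)
      where
      open ≤-Reasoning
      far′ : p * m ≤ q * (size * (s * s) + heavyCount)
      far′ = ≤-trans (ε*≤⇒ ε 0<ε m _ (far rest rest-free)) (*-monoʳ-≤ q edits)
      regroup : ∀ q z s h → q * (z * s + h) + q * (z * s + h) ≡ 2 * (h * q) + 2 * s * q * z
      regroup = solve-∀

    module _ (a : Fin size) where

      arranged : ∃ λ (π : Fin s → Fin s) → (∀ {i j} → π i ≡ π j → i ≡ j) ×
                 deg (member a (π zero)) ≤ deg (member a (π (suc zero)))
      arranged = arrangement deg (member a)

      π : Fin s → Fin s
      π = proj₁ arranged

      π-injective : ∀ {i j} → π i ≡ π j → i ≡ j
      π-injective = proj₁ (proj₂ arranged)

      arranged-clique : Clique lightGraph (member a ∘ π)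
      arranged-clique i j i≢j = clique a (π i) (π j) (i≢j ∘ π-injective)

      apex-light : p * (deg (member a (π zero)) * deg (member a (π zero))) ≤ 8 * m * q
      apex-light = ≤-trans (*-monoʳ-≤ p (*-monoʳ-≤ (deg (member a (π zero))) (proj₂ (proj₂ arranged))))
        (≮⇒≥ λ h → T-not⇒¬ (T-∧ʳ {edge graph (member a (π zero)) (member a (π (suc zero)))} (arranged-clique zero (suc zero) λ ()))
          (T-does (heavy? (member a (π zero)) (member a (π (suc zero)))) h))

  light-cliques : LightCliques N k (num ε) (den ε)
  light-cliques = record
    { size     = size
    ; member   = λ a → member a ∘ π a
    ; cliques  = λ a i j i≢j → restrict⊆ graph light light-sym _ _ (arranged-clique a i j i≢j)
    ; disjoint = λ a b a≢b i i′ j j′ → disjoint a b a≢b (π a i) (π a i′) (π b j) (π b j′)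
    ; light    = apex-light
    ; many     = many-cliques
    }

-- Parameters of the tester for cliques on 4 + f vertices

module Parameters (f : ℕ) where

  s e : ℕ
  s = 4 + f
  e = 2 + f

  -- 32 = 2² · 8 comes from blocks · 2 ^ width d ≤ 2 d and d² ≤ 8 m / ε, and 4 s² is twice the
  -- factor 2 s² in the number of edge-disjoint cliques.
  opaque
    κ : ℕ
    κ = 32 ^ e * (4 * (s * s) * (4 * (s * s)))

    κ≡ : κ ≡ 32 ^ e * (4 * (s * s) * (4 * (s * s)))
    κ≡ = refl

    κ>0 : 0 < κ
    κ>0 = *-mono-≤ (m^n>0 32 e) (s≤s z≤n)

  -- The number of blocks is the least t with t ^ 2e ≥ κ · X · ε⁻ˢ, where X stands for m ^ (s - 4).
  Enough : (p q X τ : ℕ) → Set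
  Enough p q X τ = κ * X * q ^ s ≤ suc τ ^ (2 * e) * p ^ s

  enough? : ∀ p q X τ → Dec (Enough p q X τ)
  enough? p q X τ = _ ≤? _

  chosen : (p q X : ℕ) → ℕ
  chosen p q X = descend (enough? p q X) (κ * X * q ^ s)

  chosen-enough : ∀ p q X → 0 < p → Enough p q X (chosen p q X)
  -- The start `Y` of the descent is itself large enough, since `suc Y` exceeds it already to the
  -- first power and `p ^ s ≥ 1`.
  chosen-enough p q X 0<p = descend-holds (enough? p q X) Y (begin
    Y                           ≤⟨ n≤1+n Y ⟩
    suc Y                       ≡⟨ trans (*-identityʳ _) (*-identityʳ _) ⟨
    suc Y ^ 1 * 1               ≤⟨ *-mono-≤ (^-monoʳ-≤ (suc Y) {1} {2 * e} (s≤s z≤n)) (m^n>0 p {{>-nonZero 0<p}} s) ⟩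
    suc Y ^ (2 * e) * p ^ s     ∎)
    where
    open ≤-Reasoning
    Y : ℕ
    Y = κ * X * q ^ s

  -- The number of blocks is controlled through its power `2 * e` and the degree through its square,
  -- so the inequality is proved squared. `narrow` and `light` give `(t * Z) ^ 2 * p ≤ 32 * m * q`;
  -- in its power `e`, `m ^ e` is `m * m * m ^ f`, and `Enough` lets the positive factor
  -- `32 ^ e * m ^ f * q ^ e` cancel.
  inverse-probability-bound : ∀ {p q X m τ d k} → 0 < m → 0 < q → m ^ f ≤ X → Enough p q X τ →
    p * (d * d) ≤ 8 * m * q → suc τ * 2 ^ k ≤ 2 * d → (2 ^ k) ^ e * (4 * (s * s) * q) ≤ m * p
  inverse-probability-bound {p} {q} {X} {m} {τ} {d} {k} 0<m 0<q m^f≤X enough light narrow = square-cancel-≤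
    (*-cancelˡ-≤ (32 ^ e * m ^ f * q ^ e) {{m*n≢0 _ _ {{m*n≢0 _ _ {{m^n≢0 32 e}} {{m^n≢0 m f {{>-nonZero 0<m}}}}}} {{m^n≢0 q e {{>-nonZero 0<q}}}}}} (begin
      32 ^ e * m ^ f * q ^ e * (Z ^ e * (S * q) * (Z ^ e * (S * q)))
        ≡⟨ regroup₁ (32 ^ e) (m ^ f) (q ^ e) (Z ^ e) S q ⟩
      Z ^ e * Z ^ e * (32 ^ e * (S * S) * m ^ f * q ^ s)
        ≡⟨ cong (λ x → Z ^ e * Z ^ e * (x * m ^ f * q ^ s)) κ≡ ⟨
      Z ^ e * Z ^ e * (κ * m ^ f * q ^ s)
        ≤⟨ *-monoʳ-≤ (Z ^ e * Z ^ e) (≤-trans (*-monoˡ-≤ (q ^ s) (*-monoʳ-≤ κ m^f≤X)) enough) ⟩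
      Z ^ e * Z ^ e * (t ^ (2 * e) * p ^ s)
        ≡⟨ cong (λ x → Z ^ e * Z ^ e * (x * p ^ s)) (^-double t e) ⟩
      Z ^ e * Z ^ e * ((t * t) ^ e * (p * (p * p ^ e)))
        ≡⟨ regroup₂ (Z ^ e) ((t * t) ^ e) p (p ^ e) ⟩
      Z ^ e * Z ^ e * (t * t) ^ e * p ^ e * (p * p)
        ≡⟨ cong (_* (p * p)) powers ⟩
      (Z * Z * (t * t) * p) ^ e * (p * p)
        ≤⟨ *-monoˡ-≤ (p * p) (^-monoˡ-≤ e base) ⟩
      (32 * m * q) ^ e * (p * p)
        ≡⟨ cong (_* (p * p)) (trans (^-distribʳ-* e (32 * m) q) (cong (_* q ^ e) (^-distribʳ-* e 32 m))) ⟩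
      32 ^ e * (m * (m * m ^ f)) * q ^ e * (p * p)
        ≡⟨ regroup₃ (32 ^ e) m (m ^ f) (q ^ e) p ⟩
      32 ^ e * m ^ f * q ^ e * (m * p * (m * p)) ∎))
    where
    open ≤-Reasoning
    Z t S : ℕ
    Z = 2 ^ k
    t = suc τ
    S = 4 * (s * s)
    regroup₁ : ∀ c m q z S q₁ → c * m * q * (z * (S * q₁) * (z * (S * q₁))) ≡ z * z * (c * (S * S) * m * (q₁ * (q₁ * q)))
    regroup₁ = solve-∀
    regroup₂ : ∀ z t p r → z * z * (t * (p * (p * r))) ≡ z * z * t * r * (p * p)
    regroup₂ = solve-∀
    regroup₃ : ∀ c m r q p → c * (m * (m * r)) * q * (p * p) ≡ c * r * q * (m * p * (m * p))
    regroup₃ = solve-∀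
    powers : Z ^ e * Z ^ e * (t * t) ^ e * p ^ e ≡ (Z * Z * (t * t) * p) ^ e
    powers = sym (trans (^-distribʳ-* e (Z * Z * (t * t)) p) (cong (_* p ^ e)
      (trans (^-distribʳ-* e (Z * Z) (t * t)) (cong (_* (t * t) ^ e) (^-distribʳ-* e Z Z)))))
    base : Z * Z * (t * t) * p ≤ 32 * m * q
    base = begin
      Z * Z * (t * t) * p        ≡⟨ shape Z t p ⟩
      t * Z * (t * Z) * p        ≤⟨ *-monoˡ-≤ p (*-mono-≤ narrow narrow) ⟩
      2 * d * (2 * d) * p        ≡⟨ four d p ⟩
      4 * (p * (d * d))          ≤⟨ *-monoʳ-≤ 4 light ⟩
      4 * (8 * m * q)            ≡⟨ times m q ⟩
      32 * m * q                 ∎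
      where
      shape : ∀ Z t p → Z * Z * (t * t) * p ≡ t * Z * (t * Z) * p
      shape = solve-∀
      four : ∀ d p → 2 * d * (2 * d) * p ≡ 4 * (p * (d * d))
      four = solve-∀
      times : ∀ m q → 4 * (8 * m * q) ≡ 32 * m * q
      times = solve-∀

  opaque
    -- `2 * s` pays for passing from blocks to rounds. The other factors, raised to the power
    -- `2 * e`, cover `κ` and the error `(γ * γ) ^ f` of the hint; `suc γ` keeps the base positive
    -- when `γ` is 0.
    constant : ℕ → ℕ
    constant γ = 2 * s * (κ * (suc γ * suc γ))

    constant≡ : ∀ γ → constant γ ≡ 2 * s * (κ * (suc γ * suc γ))
    constant≡ γ = refl

  -- With one block there are `s` rounds, and `p ≤ q` and `0 < m` make the right-hand side large
  -- enough. Otherwise one block fewer was not `Enough`, which bounds the power of `suc τ` from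
  -- above.
  rounds-bound : ∀ γ p q X m → 0 < p → p ≤ q → 0 < m → X ≤ (γ * γ) ^ f * m ^ f →
    (2 + e * suc (chosen p q X)) ^ (2 * e) * p ^ s ≤ constant γ ^ (2 * e) * m ^ f * q ^ s
  rounds-bound γ p q X m 0<p p≤q 0<m X≤ with chosen p q X | descend-minimal (enough? p q X) (κ * X * q ^ s)
  ... | _ | inj₁ refl = begin
    (2 + e * 1) ^ (2 * e) * p ^ s
      ≤⟨ *-mono-≤ (^-monoˡ-≤ (2 * e) few) (^-monoˡ-≤ s p≤q) ⟩
    constant γ ^ (2 * e) * q ^ s
      ≤⟨ *-monoˡ-≤ (q ^ s) (m≤m*n (constant γ ^ (2 * e)) (m ^ f) {{m^n≢0 m f {{>-nonZero 0<m}}}}) ⟩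
    constant γ ^ (2 * e) * m ^ f * q ^ s ∎
    where
    open ≤-Reasoning
    few : 2 + e * 1 ≤ constant γ
    few = begin
      2 + e * 1  ≡⟨ cong (2 +_) (*-identityʳ e) ⟩
      s          ≤⟨ m≤m+n s (s + 0) ⟩
      2 * s      ≤⟨ m≤m*n (2 * s) (κ * (suc γ * suc γ)) {{m*n≢0 κ _ {{>-nonZero κ>0}} {{_}}}} ⟩
      2 * s * (κ * (suc γ * suc γ)) ≡⟨ constant≡ γ ⟨
      constant γ ∎
  ... | _ | inj₂ (τ , refl , ¬enough) = begin
    (2 + e * (2 + τ)) ^ (2 * e) * p ^ s
      ≤⟨ *-monoˡ-≤ (p ^ s) (^-monoˡ-≤ (2 * e) grow) ⟩
    (2 * s * suc τ) ^ (2 * e) * p ^ s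
      ≡⟨ trans (cong (_* p ^ s) (^-distribʳ-* (2 * e) (2 * s) (suc τ))) (*-assoc ((2 * s) ^ (2 * e)) _ _) ⟩
    (2 * s) ^ (2 * e) * (suc τ ^ (2 * e) * p ^ s)
      ≤⟨ *-monoʳ-≤ ((2 * s) ^ (2 * e)) (<⇒≤ (≰⇒> ¬enough)) ⟩
    (2 * s) ^ (2 * e) * (κ * X * q ^ s)
      ≤⟨ *-monoʳ-≤ ((2 * s) ^ (2 * e)) (*-monoˡ-≤ (q ^ s) scale) ⟩
    (2 * s) ^ (2 * e) * (κ ^ (2 * e) * ((suc γ * suc γ) ^ (2 * e) * m ^ f) * q ^ s)
      ≡⟨ regroup ((2 * s) ^ (2 * e)) (κ ^ (2 * e)) ((suc γ * suc γ) ^ (2 * e)) (m ^ f) (q ^ s) ⟩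
    (2 * s) ^ (2 * e) * (κ ^ (2 * e) * (suc γ * suc γ) ^ (2 * e)) * m ^ f * q ^ s
      ≡⟨ cong (λ x → x * m ^ f * q ^ s) (sym (trans (cong (_^ (2 * e)) (constant≡ γ)) (trans (^-distribʳ-* (2 * e) (2 * s) (κ * (suc γ * suc γ)))
           (cong ((2 * s) ^ (2 * e) *_) (^-distribʳ-* (2 * e) κ (suc γ * suc γ)))))) ⟩
    constant γ ^ (2 * e) * m ^ f * q ^ s ∎
    where
    open ≤-Reasoning
    double : ∀ e τ → 2 + e * (2 + τ) + (2 + 2 * τ + 2 * τ + e * τ) ≡ 2 * (2 + e) * suc τ
    double = solve-∀
    grow : 2 + e * (2 + τ) ≤ 2 * s * suc τ
    grow = ≤-trans (m≤m+n (2 + e * (2 + τ)) (2 + 2 * τ + 2 * τ + e * τ)) (≤-reflexive (double e τ))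
    regroup : ∀ a b c d e → a * (b * (c * d) * e) ≡ a * (b * c) * d * e
    regroup = solve-∀
    f≤2e : f ≤ 2 * e
    f≤2e = ≤-trans (m≤n+m f 2) (m≤m+n e _)
    scale : κ * X ≤ κ ^ (2 * e) * ((suc γ * suc γ) ^ (2 * e) * m ^ f)
    scale = *-mono-≤
      (≤-trans (≤-reflexive (sym (*-identityʳ κ))) (^-monoʳ-≤ κ {{>-nonZero κ>0}} {1} {2 * e} (s≤s z≤n)))
      (≤-trans X≤ (*-monoˡ-≤ (m ^ f) (≤-trans (^-monoˡ-≤ f (*-mono-≤ (n≤1+n γ) (n≤1+n γ)))
        (^-monoʳ-≤ (suc γ * suc γ) f≤2e))))

  -- The factor `γ` makes the estimate err upwards, as detection requires. Without a hint `f` is 0,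
  -- and the power is 1 whatever the default.
  estimate-of : ℕ → Maybe ℕ → ℕ
  estimate-of γ hint = (γ * fromMaybe 0 hint) ^ f

  estimate-lower : ∀ {γ m hint} → EdgeHint γ m s hint → m ^ f ≤ estimate-of γ hint
  estimate-lower none                 = ≤-refl
  estimate-lower (estimate _ m≤ _)    = ^-monoˡ-≤ f m≤

  estimate-upper : ∀ {γ m hint} → EdgeHint γ m s hint → estimate-of γ hint ≤ (γ * γ) ^ f * m ^ f
  estimate-upper none                                  = ≤-refl
  estimate-upper {γ} {m} (estimate {m̃ = m̃} _ _ m̃≤) = begin
    (γ * m̃) ^ f          ≤⟨ ^-monoˡ-≤ f (*-monoʳ-≤ γ m̃≤) ⟩
    (γ * (γ * m)) ^ f     ≡⟨ cong (_^ f) (sym (*-assoc γ γ m)) ⟩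
    (γ * γ * m) ^ f       ≡⟨ ^-distribʳ-* f (γ * γ) m ⟩
    (γ * γ) ^ f * m ^ f   ∎
    where open ≤-Reasoning

-- Correctness with the chosen parameters

2≤vertices : ∀ {n} {u v : Fin n} → u ≢ v → 2 ≤ n
2≤vertices {suc zero}    {zero} {zero} u≢v = contradiction refl u≢v
2≤vertices {suc (suc n)} _ = s≤s (s≤s z≤n)

factor>0 : ∀ {c x} → 0 < c * x → 0 < x
factor>0 {c} {zero}  0<c*0 = contradiction (≤-reflexive (*-zeroʳ c)) (<⇒≱ 0<c*0)
factor>0 {c} {suc x} _     = z<s

-- A positive minimal width `w` means that `c * 2 ^ k` with `k = w - 1` falls short of `d`.
halve : ∀ {c d w} → w ≢ 0 → w ≡ 0 ⊎ (∃ λ k → w ≡ suc k × ¬ d ≤ c * 2 ^ k) → c * 2 ^ w ≤ 2 * d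
halve w≢0 (inj₁ w≡0) = contradiction w≡0 w≢0
halve {c} {d} _ (inj₂ (k , refl , d≰)) = ≤-trans (≤-reflexive (pull c (2 ^ k))) (*-monoʳ-≤ 2 (<⇒≤ (≰⇒> d≰)))
  where
  pull : ∀ x y → x * (2 * y) ≡ 2 * (x * y)
  pull = solve-∀

module Correctness (f γ : ℕ) (ε : ℚ) (0<ε : 0ℚ ℚ.< ε) {b} (N : Network b) {hint : Maybe ℕ}
                   (known : EdgeHint γ (edgeCount (Network.graph N)) (4 + f) hint) where

  open Parameters f
  open Network N

  private
    m p q X τ : ℕ
    m = edgeCount graph
    p = num ε
    q = den ε
    X = estimate-of γ hint
    τ = chosen p q X

  open Tester e τ b
  open On N
  open Execution protocol N

  -- A message needs a port, hence an edge, hence `n ≥ 2`; so the logarithm is at least 1 and pays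
  -- for the answer bit besides the identifier.
  bandwidth-log : ∀ c → b ≤ c * ⌈log₂ n ⌉ → Bandwidth≤ (suc c * ⌈log₂ n ⌉)
  bandwidth-log c b≤ ω t v i = ≤-trans (bandwidth ω t v i)
    (+-mono-≤ (⌈log₂⌉-mono-≤ (2≤vertices (edge⇒≢ graph (neighbour-edge v i)))) b≤)

  isolated : ¬ 0 < m → ∀ v → ¬ Fin (deg v)
  isolated ¬0<m v i = ¬0<m (edge⇒0<edgeCount graph v (neighbour v i) (neighbour-edge v i))

  module _ (0<m : 0 < m) (L : LightCliques N e p q) where

    open LightCliques L
    open Detection e τ b N

    private
      apexDegree : Fin size → ℕ
      apexDegree a = deg (member a zero)

    many-per-cylinder : (∀ a → width (apexDegree a) ≢ 0) → ∀ a → 2 * (2 ^ width (apexDegree a)) ^ e ≤ size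
    many-per-cylinder w≢0 a = *-cancelˡ-≤ (2 * (s * s) * q) (begin
      2 * (s * s) * q * (2 * W ^ e)   ≡⟨ regroup (s * s) q (W ^ e) ⟩
      W ^ e * (4 * (s * s) * q)       ≤⟨ inverse-probability-bound {p} {q} {X} {m} {τ} {apexDegree a} {width (apexDegree a)} 0<m z<s
                                           (estimate-lower known) (chosen-enough p q X (num>0 ε 0<ε)) (light a)
                                           (halve {blocks} (w≢0 a) (descend-minimal (λ k → apexDegree a ≤? blocks * 2 ^ k) b)) ⟩
      m * p                           ≡⟨ *-comm m p ⟩
      p * m                           ≤⟨ many ⟩
      2 * (s * s) * q * size          ∎)
      where
      open ≤-Reasoning
      W : ℕ
      W = 2 ^ width (apexDegree a)
      regroup : ∀ s q w → 2 * s * q * (2 * w) ≡ w * (4 * s * q)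
      regroup = solve-∀

    -- Only a positive width satisfies the estimate of `halve`, so an apex of width 0 is treated
    -- apart.
    detects : ℤ.+ 2 ℚ./ 3 ℚ.≤ Pr (someRejects? rounds)
    detects = conclude (Fin.any? λ a → width (apexDegree a) ≟ 0)
      where
      conclude : Dec (∃ λ a → width (apexDegree a) ≡ 0) → ℤ.+ 2 ℚ./ 3 ℚ.≤ Pr (someRejects? rounds)
      conclude (yes (a , w≡0)) = detected-surely member cliques disjoint a w≡0
      conclude (no ¬w≡0)       = detected-likely member cliques disjoint
        (factor>0 {2 * (s * s) * q} (≤-trans (*-mono-< (num>0 ε 0<ε) 0<m) many))
        (many-per-cylinder λ a w≡0 → ¬w≡0 (a , w≡0))

  Tested : Set
  Tested = ∃ λ t → RoundBound s (constant γ) ε m t × HaltsWithin t × OneSidedTester (K s) ε protocol N t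

  tester : ε ℚ.≤ 1ℚ → Tested
  tester ε≤1 = conclude (0 <? m)
    where
    conclude : Dec (0 < m) → Tested
    conclude (yes 0<m) = rounds ,
      power-≤ ε 0<ε s (rounds ^ (2 * e)) (constant γ ^ (2 * e) * m ^ f)
        (rounds-bound γ p q X m (num>0 ε 0<ε) (num≤den ε 0<ε ε≤1) 0<m (estimate-upper known)) ,
      halts ,
      record
        { complete = λ free → Pr-certain (allAccept? rounds) (free⇒accept free)
        ; sound    = λ 0<m far → detects 0<m (light-cliques N e ε 0<ε 0<m far)
        }
    -- For `f > 0` the bound is 0 when there are no edges, so here the output must be present before
    -- any round.
    conclude (no ¬0<m) = 0 ,
      power-≤ ε 0<ε s 0 (constant γ ^ (2 * e) * m ^ f) z≤n ,
      isolated-halts (isolated ¬0<m) ,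
      record
        { complete = λ _ → Pr-certain (allAccept? 0) λ ω v → output-isolated ω 0 v (isolated ¬0<m v)
        ; sound    = λ 0<m → contradiction 0<m ¬0<m
        }

theorem6p4 : (s : ℕ) → 4 ≤ s → (c γ : ℕ) →
    Σ Algorithm λ A → ∃ λ (B : ℕ) → ∃ λ (C : ℕ) →
    (ε : ℚ) → 0ℚ ℚ.< ε → ε ℚ.≤ 1ℚ →
    (b : ℕ) (N : Network b) → b ≤ c * ⌈log₂ Network.n N ⌉ →
    (hint : Maybe ℕ) → EdgeHint γ (edgeCount (Network.graph N)) s hint →
    Execution.Bandwidth≤ (A ε hint b) N (B * ⌈log₂ Network.n N ⌉) ×
    ∃ λ (t : ℕ) →
    RoundBound s C ε (edgeCount (Network.graph N)) t ×
    Execution.HaltsWithin (A ε hint b) N t ×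
    OneSidedTester (K s) ε (A ε hint b) N t
theorem6p4 (suc (suc (suc (suc f)))) (s≤s (s≤s (s≤s (s≤s z≤n)))) c γ =
  (λ ε hint b → Tester.protocol e (chosen (num ε) (den ε) (estimate-of γ hint)) b) , suc c , constant γ ,
  λ ε 0<ε ε≤1 b N b≤ hint known →
    let open Correctness f γ ε 0<ε N known in bandwidth-log c b≤ , tester ε≤1
  where open Parameters f
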